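{- Let $G$ be a finite simple graph with $n \ge 1$ vertices. For each vertex $v \in V(G)$ let $c(v)$ denote the largest integer $k$ such that $v$ lies in a subgraph of $G$ isomorphic to the complete graph $K_k$ (so an isolated vertex has $c(v)=1$). Then \[ |E(G)| \le \left\lfloor \frac{n}{2}\sum_{v\in V(G)} \frac{c(v)-1}{c(v)} \right\rfloor . \] Moreover, equality holds if and only if $G \in \mathcal{S} \cup \{X, Y\}$, where $\mathcal{S}$, $X$, $Y$ are as defined in the context.
   Context: For positive integers $n$ and $r$, the Turán graph $T(n,r)$ is the complete multipartite graph on $n$ vertices with $r$ classes, each of size $\lceil n/r\rceil$ or $\lfloor n/r\rfloor$. $\mathcal{S}$ denotes the class of graphs isomorphic to some Turán graph $T(n,r)$ such that, writing $s$ for the remainder of $n$ modulo $r$ (so $n \equiv s \pmod r$, $0 \le s < r$), either $s \le 2$ or $r < \frac{s^2}{s-2}$. $P_k$ denotes the path on $k$ vertices and $\overline{H}$ the complement of a graph $H$. $X$ is the graph $\overline{P_2 \cup P_3}$ on 5 vertices (the "paraglider": a triangle $abc$ plus vertices $d$ and $e$, where $d$ is adjacent to $a,b,c$... equivalently the complement of the disjoint union of an edge and a 3-vertex path), and $Y$ is the graph $\overline{P_3}$ (an edge together with an isolated vertex). -}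

module Defs where

open import Data.Nat using (ℕ; zero; suc; _∸_; _%_; _<_; _≤_; _*_; _<ᵇ_; _≡ᵇ_)
open import Data.Bool using (Bool; true; false; _∧_; not; if_then_else_)
open import Data.Fin using (Fin; toℕ)
open import Data.List using (List; []; _∷_; length; map; allFin)
open import Data.Nat.ListAction using (sum)
open import Data.List.Membership.Propositional using (_∈_)
open import Data.List.Relation.Unary.AllPairs using (AllPairs)
open import Data.Product using (Σ; _×_; ∃)
open import Data.Sum using (_⊎_)
open import Data.Integer using (ℤ; +_)
open import Data.Rational using (ℚ; _/_; floor; 0ℚ) renaming (_+_ to _+ℚ_; _*_ to _*ℚ_)
open import Function.Bundles using (_↔_; Inverse)
open import Relation.Binary.PropositionalEquality using (_≡_; refl; cong; cong₂)
open import Data.Bool.Properties using (∧-comm)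

record Graph (n : ℕ) : Set where
  field
    adj   : Fin n → Fin n → Bool
    sym   : ∀ u v → adj u v ≡ adj v u
    irrefl : ∀ v → adj v v ≡ false
open Graph public

edgeCount : ∀ {n} → Graph n → ℕ
edgeCount {n} G =
  sum (map (λ u → sum (map (λ v → if (toℕ u <ᵇ toℕ v) ∧ adj G u v then 1 else 0)
                           (allFin n)))
           (allFin n))

-- A clique: a list of vertices that are pairwise adjacent
-- (hence pairwise distinct, by irreflexivity).
IsClique : ∀ {n} → Graph n → List (Fin n) → Set
IsClique G vs = AllPairs (λ u v → adj G u v ≡ true) vs

IsVertexCliqueNumber : ∀ {n} → Graph n → Fin n → ℕ → Set
IsVertexCliqueNumber G v k =
  (Σ (List _) λ vs → IsClique G vs × v ∈ vs × length vs ≡ k)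
  × (∀ vs → IsClique G vs → v ∈ vs → length vs ≤ k)

-- (k - 1)/k as a rational (k = 0 never occurs for clique numbers; sent to 0).
frac : ℕ → ℚ
frac zero = 0ℚ
frac (suc m) = (+ m) / suc m

sumℚ : List ℚ → ℚ
sumℚ [] = 0ℚ
sumℚ (x ∷ xs) = x +ℚ sumℚ xs

bound : (n : ℕ) → (Fin n → ℕ) → ℤ
bound n c = floor (((+ n) / 2) *ℚ sumℚ (map (λ v → frac (c v)) (allFin n)))

_≅_ : ∀ {n m} → Graph n → Graph m → Set
_≅_ {n} {m} G H =
  Σ (Fin n ↔ Fin m) λ f → ∀ u v → adj H (Inverse.to f u) (Inverse.to f v) ≡ adj G u v

≡ᵇ-sym : ∀ a b → (a ≡ᵇ b) ≡ (b ≡ᵇ a)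
≡ᵇ-sym zero zero = refl
≡ᵇ-sym zero (suc b) = refl
≡ᵇ-sym (suc a) zero = refl
≡ᵇ-sym (suc a) (suc b) = ≡ᵇ-sym a b

≡ᵇ-refl : ∀ a → (a ≡ᵇ a) ≡ true
≡ᵇ-refl zero = refl
≡ᵇ-refl (suc a) = ≡ᵇ-refl a

mkGraph : (n : ℕ) → (ℕ → ℕ → Bool) → Graph n
mkGraph n E = record
  { adj = λ u v → not (toℕ u ≡ᵇ toℕ v) ∧ (E (toℕ u) (toℕ v) ∧ E (toℕ v) (toℕ u))
  ; sym = λ u v → cong₂ _∧_ (cong not (≡ᵇ-sym (toℕ u) (toℕ v)))
                            (∧-comm (E (toℕ u) (toℕ v)) (E (toℕ v) (toℕ u)))
  ; irrefl = λ v → cong (λ b → not b ∧ (E (toℕ v) (toℕ v) ∧ E (toℕ v) (toℕ v)))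
                        (≡ᵇ-refl (toℕ v))
  }

-- Turán graph T(n, r) with r = suc k ≥ 1: vertex i lies in class (i mod r);
-- two vertices are adjacent iff they lie in different classes.  The r classes
-- have sizes ⌈n/r⌉ or ⌊n/r⌋.
turán : (n k : ℕ) → Graph n
turán n k = mkGraph n (λ a b → not ((a % suc k) ≡ᵇ (b % suc k)))

-- The class 𝒮: G ≅ T(n, r) for some r ≥ 1 with s = n mod r satisfying
-- s ≤ 2 or r < s²/(s-2)  (for s > 2 the latter is r (s - 2) < s²).
InS : ∀ {n} → Graph n → Set
InS {n} G = Σ ℕ λ k →
  ((n % suc k ≤ 2) ⊎ (suc k * (n % suc k ∸ 2) < (n % suc k) * (n % suc k)))
  × (G ≅ turán n k)

P2∪P3-edge : ℕ → ℕ → Bool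
P2∪P3-edge 0 1 = true
P2∪P3-edge 2 3 = true
P2∪P3-edge 3 4 = true
P2∪P3-edge _ _ = false

X : Graph 5
X = mkGraph 5 (λ a b → not (P2∪P3-edge a b))

P3-edge : ℕ → ℕ → Bool
P3-edge 0 1 = true
P3-edge 1 2 = true
P3-edge _ _ = false

Y : Graph 3
Y = mkGraph 3 (λ a b → not (P3-edge a b))

{-# OPTIONS --safe #-}

-- Let W(v) = M / c(v) for a common multiple M of all c(v), and let ne(L) be the number of ordered
-- non-adjacent pairs (including v, v) in a list L of vertices.  The bound reads |L| ∑ W ≤ M ne(L).
-- Remove a maximum clique K, |K| = ω, from L: a remaining vertex v with d non-neighbours in K satisfies
-- d ≥ 1 and d ≥ ω + 1 - c(v), hence M + ω W(v) ≤ 2 M d, and summing over v gives the inductive step.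
-- Equality with the floor means that the total defect is below 2M.  Each defect 2 M d - M - ω W(v) is
-- then below 2M, which forces c(v) = ω, d = 1, or c(v) = ω - 1, d = 2, the latter for at most one vertex.
-- If c = ω throughout, non-adjacency is transitive and the classes are balanced, so G is a Turán graph.
-- If there is an exceptional vertex, comparing the remaining vertices with Turán's bound leaves at most
-- two of them, which gives Y and X.
module Submission where

open import Defs
open import Data.Bool using (Bool; true; false; T; _∧_; not; if_then_else_)
open import Data.Bool.Properties using (∧-zeroʳ) renaming (_≟_ to _≟ᵇ_)
open import Data.Empty using (⊥; ⊥-elim)
open import Data.Fin using (Fin; zero; suc; toℕ; fromℕ<)
open import Data.Fin.Patterns using (0F; 1F; 2F; 3F; 4F)
import Data.Fin.Properties as Fin
open import Data.List using (List; []; _∷_; _++_; length; map; allFin; filter; lookup; tabulate; applyUpTo; upTo)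
open import Data.List.Membership.DecPropositional using (_∈?_)
open import Data.List.Membership.Propositional using (_∈_; find)
open import Data.List.Membership.Propositional.Properties using (∈-∃++; ∈-allFin; ∈-++⁺ʳ; ∈-++⁻; ∈-map⁺; ∈-map⁻; ∈-lookup; ∈-AllPairs₂)
open import Data.List.Properties using (length-map; length-++; length-tabulate; map-++; map-∘; map-tabulate; ++-identityʳ; upTo-∷ʳ)
open import Data.List.Relation.Binary.Permutation.Propositional using (_↭_; ↭-refl; ↭-sym; ↭-trans; ↭-reflexive; prep; swap; ↭⇒↭ₛ)
open import Data.List.Relation.Binary.Permutation.Propositional.Properties using (map⁺; shift; ++⁺ˡ; ++⁺ʳ; ↭-length; ∈-resp-↭; All-resp-↭)
import Data.List.Relation.Binary.Permutation.Setoid.Properties as SetoidPerm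
open import Data.List.Relation.Unary.All as All using (All; []; _∷_)
import Data.List.Relation.Unary.All.Properties as AllP
open import Data.List.Relation.Unary.AllPairs as AllPairs using (AllPairs; []; _∷_)
import Data.List.Relation.Unary.AllPairs.Properties as AllPairsP
open import Data.List.Relation.Unary.Any using (here; there)
import Data.List.Relation.Unary.Linked.Properties as Linked
open import Data.List.Relation.Unary.Unique.Propositional using (Unique)
import Data.List.Relation.Unary.Unique.Propositional.Properties as UniqueP
import Data.List.Sort as Sort
open import Data.Nat using (ℕ; zero; suc; _+_; _*_; _∸_; _%_; _≤_; _<_; _≥_; _≡ᵇ_; _<ᵇ_; z≤n; s≤s; NonZero; >-nonZero)
open import Data.Nat.DivMod using ([m+kn]%n≡m%n; m<n⇒m%n≡m; m%n<n)
open import Data.Nat.Divisibility using (_∣_; quotient; m∣n⇒n≡m*quotient)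
open import Data.Nat.ListAction using (sum; product)
open import Data.Nat.ListAction.Properties using (sum-++; sum-↭; product≢0; ∈⇒∣product)
open import Data.Nat.Properties
open import Data.Nat.Tactic.RingSolver using (solve-∀)
open import Data.Product using (Σ; ∃; _×_; _,_; proj₁; proj₂)
open import Data.Sum using (_⊎_; inj₁; inj₂)
open import Function using (_∘_; const; id)
open import Function.Bundles using (_↔_; _⇔_; Inverse; mk↔ₛ′; mk⇔)
open import Function.Properties.Inverse using (↔-sym)
import Relation.Binary.Construct.Flip.EqAndOrd as Flip
import Relation.Binary.Construct.On as On
open import Relation.Binary.Definitions using (Symmetric; tri<; tri≈; tri>)
open import Relation.Binary.PropositionalEquality as ≡ using (_≡_; _≢_; refl; cong; cong₂; subst; subst₂; module ≡-Reasoning)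
open import Relation.Nullary using (¬_; Dec; yes; no; contradiction)
open import Relation.Nullary.Decidable using (from-yes; _→-dec_)

-- The weights clear denominators: with q the rational under the floor and ne(V) = n² - 2|E|, one
-- has 2M (q - |E|) = M ne(V) - n ∑ W. So |E| ≤ q says that this defect is non-negative, and |E| =
-- floor q adds exactly that it is below 2M. The obstacle to an induction over induced subgraphs is
-- that clique numbers drop when vertices are removed. Hence the weights of the whole graph are
-- kept, and the induction assumes only that a clique inside L through v has at most c(v) vertices,
-- a condition inherited by sublists. In this form the inequality also admits constant functions c,
-- which turns it into Turán's theorem. The analysis of equality uses that special case again, both
-- to balance the classes and to count the vertices left in the exceptional case. Lists are used
-- instead of sets because a repeated entry acts as a non-adjacent twin, so that replacing a vertex
-- by a copy of another one needs no new graph.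

private variable
  A B : Set

-- Finite sums over lists, permutations, and removal of sublists.

∑ : List A → (A → ℕ) → ℕ
∑ xs f = sum (map f xs)

∑-cong : ∀ (xs : List A) {f g : A → ℕ} → (∀ {x} → x ∈ xs → f x ≡ g x) → ∑ xs f ≡ ∑ xs g
∑-cong []       eq = refl
∑-cong (x ∷ xs) eq = cong₂ _+_ (eq (here refl)) (∑-cong xs (eq ∘ there))

∑-mono-≤ : ∀ (xs : List A) {f g : A → ℕ} → (∀ {x} → x ∈ xs → f x ≤ g x) → ∑ xs f ≤ ∑ xs g
∑-mono-≤ []       le = z≤n
∑-mono-≤ (x ∷ xs) le = +-mono-≤ (le (here refl)) (∑-mono-≤ xs (le ∘ there))

∑-mono-< : ∀ (xs : List A) {f g : A → ℕ} → (∀ {x} → x ∈ xs → f x ≤ g x) →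
           ∀ {y} → y ∈ xs → f y < g y → ∑ xs f < ∑ xs g
∑-mono-< (x ∷ xs) le (here refl) lt = +-mono-<-≤ lt (∑-mono-≤ xs (le ∘ there))
∑-mono-< (x ∷ xs) le (there y∈)  lt = +-mono-≤-< (le (here refl)) (∑-mono-< xs (le ∘ there) y∈ lt)

∑-distrib-+ : ∀ (xs : List A) (f g : A → ℕ) → ∑ xs (λ x → f x + g x) ≡ ∑ xs f + ∑ xs g
∑-distrib-+ []       f g = refl
∑-distrib-+ (x ∷ xs) f g = ≡.trans (cong (f x + g x +_) (∑-distrib-+ xs f g)) (eq (f x) (g x) _ _)
  where
  eq : ∀ a b c d → a + b + (c + d) ≡ a + c + (b + d)
  eq = solve-∀

*-distribˡ-∑ : ∀ (xs : List A) m (f : A → ℕ) → ∑ xs (λ x → m * f x) ≡ m * ∑ xs f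
*-distribˡ-∑ []       m f = ≡.sym (*-zeroʳ m)
*-distribˡ-∑ (x ∷ xs) m f = ≡.trans (cong (m * f x +_) (*-distribˡ-∑ xs m f)) (≡.sym (*-distribˡ-+ m (f x) _))

∑-const : ∀ (xs : List A) m → ∑ xs (const m) ≡ length xs * m
∑-const []       m = refl
∑-const (x ∷ xs) m = cong (m +_) (∑-const xs m)

∑-++ : ∀ (xs ys : List A) f → ∑ (xs ++ ys) f ≡ ∑ xs f + ∑ ys f
∑-++ xs ys f = ≡.trans (cong sum (map-++ f xs ys)) (sum-++ (map f xs) (map f ys))

∑-↭ : ∀ {xs ys : List A} f → xs ↭ ys → ∑ xs f ≡ ∑ ys f
∑-↭ f p = sum-↭ (map⁺ f p)

∑-map : ∀ (xs : List A) (h : A → B) f → ∑ (map h xs) f ≡ ∑ xs (f ∘ h)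
∑-map xs h f = cong sum (≡.sym (map-∘ xs))

∑-comm : ∀ (xs : List A) (ys : List B) (f : A → B → ℕ) → ∑ xs (λ x → ∑ ys (f x)) ≡ ∑ ys (λ y → ∑ xs (λ x → f x y))
∑-comm []       ys f = ≡.sym (≡.trans (∑-const ys 0) (*-zeroʳ (length ys)))
∑-comm (x ∷ xs) ys f = ≡.trans (cong (∑ ys (f x) +_) (∑-comm xs ys f)) (≡.sym (∑-distrib-+ ys (f x) _))

∈⇒≤∑ : ∀ {xs : List A} f {x} → x ∈ xs → f x ≤ ∑ xs f
∈⇒≤∑ f (here refl) = m≤m+n _ _
∈⇒≤∑ f (there x∈)  = ≤-trans (∈⇒≤∑ f x∈) (m≤n+m _ _)

AllPairs-resp-↭ : ∀ {R : A → A → Set} → Symmetric R → ∀ {xs ys} → xs ↭ ys → AllPairs R xs → AllPairs R ys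
AllPairs-resp-↭ {R = R} sym p =
  SetoidPerm.AllPairs-resp-↭ (≡.setoid _) sym (≡.resp₂ R) (↭⇒↭ₛ p)

∈⇒↭ : ∀ {x : A} {xs} → x ∈ xs → ∃ λ ys → xs ↭ x ∷ ys
∈⇒↭ {x = x} x∈ with ys , zs , refl ← ∈-∃++ x∈ = ys ++ zs , shift x ys zs

∈-tail : ∀ {x y : A} {xs} → x ≢ y → x ∈ y ∷ xs → x ∈ xs
∈-tail x≢y (here x≡y) = contradiction x≡y x≢y
∈-tail x≢y (there x∈) = x∈

-- Plays the part of set difference: `zs` is what remains of `ys` once `xs` is taken out.
Unique-⊆⇒↭++ : ∀ {xs ys : List A} → Unique xs → All (_∈ ys) xs → ∃ λ zs → ys ↭ xs ++ zs
Unique-⊆⇒↭++ {ys = ys} []     []       = ys , ↭-refl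
Unique-⊆⇒↭++ (x∉ ∷ u) (x∈ ∷ sub) with ∈⇒↭ x∈
... | ys′ , p with Unique-⊆⇒↭++ u (All.zipWith (λ (x≢y , y∈) → ∈-tail (x≢y ∘ ≡.sym) (∈-resp-↭ p y∈)) (x∉ , sub))
...   | zs , q = zs , ↭-trans p (prep _ q)

Unique-⊆⇒length≤ : ∀ {xs ys : List A} → Unique xs → All (_∈ ys) xs → length xs ≤ length ys
Unique-⊆⇒length≤ {xs = xs} u sub with zs , p ← Unique-⊆⇒↭++ u sub =
  subst (length xs ≤_) (≡.sym (≡.trans (↭-length p) (length-++ xs))) (m≤m+n _ _)

Unique-⊆-full⇒↭ : ∀ {xs ys : List A} → Unique xs → All (_∈ ys) xs → length ys ≤ length xs → ys ↭ xs
Unique-⊆-full⇒↭ {xs = xs} u sub le with Unique-⊆⇒↭++ u sub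
... | []     , p = ↭-trans p (↭-reflexive (++-identityʳ xs))
... | z ∷ zs , p = contradiction
  (≤-trans (≤-reflexive (≡.sym (≡.trans (↭-length p) (length-++ xs)))) le)
  (<⇒≱ (m<m+n (length xs) (s≤s z≤n)))

length-allFin : ∀ n → length (allFin n) ≡ n
length-allFin n = length-tabulate id

-- Non-adjacent pairs and maximum cliques in lists of vertices.

module Peeling {n : ℕ} (G : Graph n) where

  private variable
    u v : Fin n
    K L : List (Fin n)

  nonadj : Fin n → Fin n → ℕ
  nonadj u v = if adj G u v then 0 else 1

  nonNbrs : List (Fin n) → Fin n → ℕ
  nonNbrs L v = ∑ L (nonadj v)

  -- Counts ordered pairs, including (v, v); repeated entries of L count as non-adjacent twins.
  nonEdges : List (Fin n) → ℕ
  nonEdges L = ∑ L (nonNbrs L)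

  adj-sym : Symmetric (λ u v → adj G u v ≡ true)
  adj-sym {u} {v} uv = ≡.trans (Graph.sym G v u) uv

  adj⇒≢ : adj G u v ≡ true → u ≢ v
  adj⇒≢ {u} uv refl with () ← ≡.trans (≡.sym (irrefl G u)) uv

  nonadj-sym : ∀ u v → nonadj u v ≡ nonadj v u
  nonadj-sym u v = cong (if_then 0 else 1) (Graph.sym G u v)

  nonadj-refl : ∀ v → nonadj v v ≡ 1
  nonadj-refl v = cong (if_then 0 else 1) (irrefl G v)

  nonadj-adj : adj G u v ≡ true → nonadj u v ≡ 0
  nonadj-adj uv = cong (if_then 0 else 1) uv

  nonadj-¬adj : adj G u v ≡ false → nonadj u v ≡ 1
  nonadj-¬adj uv = cong (if_then 0 else 1) uv

  nonEdges-↭ : K ↭ L → nonEdges K ≡ nonEdges L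
  nonEdges-↭ {K} p = ≡.trans (∑-cong K (λ {v} _ → ∑-↭ (nonadj v) p)) (∑-↭ _ p)

  nonEdges-++ : ∀ K L → nonEdges (K ++ L) ≡ nonEdges K + 2 * ∑ L (nonNbrs K) + nonEdges L
  nonEdges-++ K L = begin
    ∑ (K ++ L) (nonNbrs (K ++ L))
      ≡⟨ ∑-cong (K ++ L) (λ {v} _ → ∑-++ K L (nonadj v)) ⟩
    ∑ (K ++ L) (λ v → nonNbrs K v + nonNbrs L v)
      ≡⟨ ∑-++ K L _ ⟩
    ∑ K (λ v → nonNbrs K v + nonNbrs L v) + ∑ L (λ v → nonNbrs K v + nonNbrs L v)
      ≡⟨ cong₂ _+_ (∑-distrib-+ K _ _) (∑-distrib-+ L _ _) ⟩
    nonEdges K + ∑ K (nonNbrs L) + (∑ L (nonNbrs K) + nonEdges L)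
      ≡⟨ cong (λ x → nonEdges K + x + (∑ L (nonNbrs K) + nonEdges L)) (≡.trans (∑-comm K L nonadj) (∑-cong L (λ {v} _ → ∑-cong K λ {u} _ → nonadj-sym u v))) ⟩
    nonEdges K + ∑ L (nonNbrs K) + (∑ L (nonNbrs K) + nonEdges L)
      ≡⟨ eq (nonEdges K) _ _ ⟩
    nonEdges K + 2 * ∑ L (nonNbrs K) + nonEdges L ∎
    where
    open ≡-Reasoning
    eq : ∀ a b c → a + b + (b + c) ≡ a + 2 * b + c
    eq = solve-∀

  nonEdges-∷ : ∀ v L → nonEdges (v ∷ L) ≡ 1 + 2 * nonNbrs L v + nonEdges L
  nonEdges-∷ v L = ≡.trans (nonEdges-++ (v ∷ []) L)
    (cong₂ (λ x y → x + 2 * y + nonEdges L)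
      (cong (λ x → x + 0 + 0) (nonadj-refl v))
      (∑-cong L λ {u} _ → ≡.trans (+-identityʳ _) (nonadj-sym u v)))

  nonNbrs≡0⁺ : All (λ u → adj G v u ≡ true) L → nonNbrs L v ≡ 0
  nonNbrs≡0⁺ []       = refl
  nonNbrs≡0⁺ (vx ∷ p) = cong₂ _+_ (nonadj-adj vx) (nonNbrs≡0⁺ p)

  nonNbrs≡0⁻ : ∀ L → nonNbrs L v ≡ 0 → All (λ u → adj G v u ≡ true) L
  nonNbrs≡0⁻         []      _  = []
  nonNbrs≡0⁻ {v = v} (x ∷ L) eq with adj G v x in vx
  ... | true = vx ∷ nonNbrs≡0⁻ L eq

  Clique : List (Fin n) → List (Fin n) → Set
  Clique L K = IsClique G K × All (_∈ L) K

  IsClique⇒Unique : IsClique G K → Unique K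
  IsClique⇒Unique = AllPairs.map adj⇒≢

  nonNbrs-clique : IsClique G K → v ∈ K → nonNbrs K v ≡ 1
  nonNbrs-clique (p ∷ _)  (here refl) = cong₂ _+_ (nonadj-refl _) (nonNbrs≡0⁺ p)
  nonNbrs-clique (p ∷ cl) (there v∈)  =
    cong₂ _+_ (nonadj-adj (adj-sym (All.lookup p v∈))) (nonNbrs-clique cl v∈)

  nonEdges-clique : IsClique G K → nonEdges K ≡ length K
  nonEdges-clique {K} cl =
    ≡.trans (∑-cong K (nonNbrs-clique cl)) (≡.trans (∑-const K 1) (*-identityʳ _))

  nbrs : List (Fin n) → Fin n → List (Fin n)
  nbrs K v = filter (λ u → adj G v u ≟ᵇ true) K

  length-nbrs : ∀ K v → length (nbrs K v) + nonNbrs K v ≡ length K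
  length-nbrs []      v = refl
  length-nbrs (x ∷ K) v with adj G v x
  ... | true  = cong suc (length-nbrs K v)
  ... | false = ≡.trans (+-suc _ _) (cong suc (length-nbrs K v))

  clique-nbrs : Clique L K → v ∈ L → Clique L (v ∷ nbrs K v)
  clique-nbrs {K = K} {v} (cl , sub) v∈ =
      AllP.all-filter (λ u → adj G v u ≟ᵇ true) K ∷ AllPairsP.filter⁺ (λ u → adj G v u ≟ᵇ true) cl
    , v∈ ∷ AllP.filter⁺ (λ u → adj G v u ≟ᵇ true) sub

  MaxClique : List (Fin n) → List (Fin n) → Set
  MaxClique L K = Clique L K × (∀ K′ → Clique L K′ → length K′ ≤ length K)

  private
    -- A clique of `x ∷ L` either avoids `x` or consists of `x` and a clique among its neighbours in
    -- `L`. Strengthening `P` expresses the second option without filtering `L`, which keeps the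
    -- recursion structural.
    maxCliqueWithin : ∀ (P : Fin n → Bool) L → ∃ λ K → (Clique L K × All (λ v → P v ≡ true) K) ×
      (∀ K′ → Clique L K′ → All (λ v → P v ≡ true) K′ → length K′ ≤ length K)
    maxCliqueWithin P [] = [] , (([] , []) , []) , λ where
      []      _               _ → z≤n
      (_ ∷ _) (_ , () ∷ _) _
    maxCliqueWithin P (x ∷ L)
      with maxCliqueWithin P L | maxCliqueWithin (λ y → P y ∧ adj G x y) L | P x in Px
    ... | K₀ , ((cl₀ , sub₀) , p₀) , max₀ | _ | false =
      K₀ , ((cl₀ , All.map there sub₀) , p₀) , λ K′ (cl , sub) p →
        max₀ K′ (cl , All.zipWith (λ (y∈ , Py) → ∈-tail (λ { refl → case-⊥ Px Py }) y∈) (sub , p)) p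
      where
      case-⊥ : ∀ {b} → b ≡ false → b ≡ true → ⊥
      case-⊥ refl ()
    ... | K₀ , ((cl₀ , sub₀) , p₀) , max₀ | K₁ , ((cl₁ , sub₁) , p₁) , max₁ | true =
      choose (≤-total (length K₀) (suc (length K₁)))
      where
      ∧-l : ∀ {a b} → a ∧ b ≡ true → a ≡ true
      ∧-l {true} _ = refl
      ∧-r : ∀ {a b} → a ∧ b ≡ true → b ≡ true
      ∧-r {true} eq = eq
      bound-by : ∀ m → length K₀ ≤ m → suc (length K₁) ≤ m →
        ∀ K′ → Clique (x ∷ L) K′ → All (λ v → P v ≡ true) K′ → length K′ ≤ m
      bound-by m le₀ le₁ K′ (cl , sub) p with _∈?_ Fin._≟_ x K′
      ... | no  x∉ = ≤-trans (max₀ K′ (cl , All.tabulate (λ y∈ → ∈-tail (λ { refl → x∉ y∈ }) (All.lookup sub y∈))) p) le₀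
      ... | yes x∈ with K″ , perm ← ∈⇒↭ x∈
                   with cl″ ← AllPairs-resp-↭ adj-sym perm cl
                   | sub″ ← All-resp-↭ perm sub | p″ ← All-resp-↭ perm p
                   with xa ∷ cl‴ ← cl″ | _ ∷ sub‴ ← sub″ | _ ∷ p‴ ← p″ =
        ≤-trans (≤-reflexive (↭-length perm)) (≤-trans (s≤s
          (max₁ K″ (cl‴ , All.zipWith (λ (xy , y∈) → ∈-tail (adj⇒≢ (adj-sym xy)) y∈) (xa , sub‴))
            (All.zipWith (λ (Py , xy) → cong₂ _∧_ Py xy) (p‴ , xa)))) le₁)
      choose : length K₀ ≤ suc (length K₁) ⊎ suc (length K₁) ≤ length K₀ → _
      choose (inj₁ le) = x ∷ K₁
        , ((All.map ∧-r p₁ ∷ cl₁ , here refl ∷ All.map there sub₁) , Px ∷ All.map ∧-l p₁)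
        , bound-by _ le ≤-refl
      choose (inj₂ le) = K₀ , ((cl₀ , All.map there sub₀) , p₀) , bound-by _ ≤-refl le

  maxClique : ∀ L → ∃ (MaxClique L)
  maxClique L with K , (cl , _) , max ← maxCliqueWithin (const true) L =
    K , cl , λ K′ cl′ → max K′ cl′ (All.tabulate λ _ → refl)

  split : IsClique G K → All (_∈ L) K → ∃ λ L′ → L ↭ K ++ L′
  split cl sub = Unique-⊆⇒↭++ (IsClique⇒Unique cl) sub

-- The weighted inequality, by removing maximum cliques.

module Weighted {n : ℕ} (G : Graph n) (M : ℕ) (M>0 : 0 < M) (c W : Fin n → ℕ) (cW≡M : ∀ v → c v * W v ≡ M) where
  open Peeling G

  private variable
    u v : Fin n
    K L L′ : List (Fin n)

  CliqueBound : List (Fin n) → Set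
  CliqueBound L = ∀ {v} K → Clique L K → v ∈ K → length K ≤ c v

  CliqueBound-⊆ : (∀ {v} → v ∈ L′ → v ∈ L) → CliqueBound L → CliqueBound L′
  CliqueBound-⊆ sub ub K (cl , K⊆) = ub K (cl , All.map sub K⊆)

  0<c : ∀ v → 0 < c v
  0<c v with c v | cW≡M v
  ... | zero  | refl = M>0
  ... | suc _ | _    = s≤s z≤n

  -- The surplus of `v` in M + ω W(v) ≤ 2 M d. The subtraction is truncated; `slack-eq` shows that
  -- nothing is lost when `K` is a maximum clique of a list that obeys `CliqueBound` and contains
  -- `v`.
  slack : List (Fin n) → Fin n → ℕ
  slack K v = 2 * M * nonNbrs K v ∸ (M + length K * W v)

  -- Together with its neighbours in `K`, the vertex `v` forms a clique of `L`, which cannot be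
  -- longer than `K`. This covers `v` in `K` as well, where `v` is its own non-neighbour.
  1≤nonNbrs : MaxClique L K → v ∈ L → 1 ≤ nonNbrs K v
  1≤nonNbrs {K = K} {v} (cl , max) v∈ = +-cancelˡ-≤ (length (nbrs K v)) _ _
    (≤-trans (≤-reflexive (+-comm _ 1))
      (≤-trans (max _ (clique-nbrs cl v∈)) (≤-reflexive (≡.sym (length-nbrs K v)))))

  -- The clique formed by `v` and its neighbours in `K` runs through `v`, so it has at most `c v`
  -- elements.
  length<c+nonNbrs : Clique L K → CliqueBound L → v ∈ L → length K < c v + nonNbrs K v
  length<c+nonNbrs {K = K} {v} cl ub v∈ = begin
    suc (length K)                          ≡⟨ cong suc (length-nbrs K v) ⟨
    suc (length (nbrs K v) + nonNbrs K v)   ≤⟨ +-monoˡ-≤ _ (ub _ (clique-nbrs cl v∈) (here refl)) ⟩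
    c v + nonNbrs K v                       ∎
    where open ≤-Reasoning

  private
    -- With ω at most c + d - 1, the difference 2cd - c - ω is at least (2c - 1)(d - 1).
    core : ∀ {c ω d} → 0 < c → 0 < d → ω < c + d → c + ω ≤ 2 * c * d
    core {suc c} {ω} {suc e} _ _ lt = begin
      suc c + ω                             ≤⟨ +-monoʳ-≤ (suc c) (≤-pred (≤-trans lt (≤-reflexive (+-suc (suc c) e)))) ⟩
      suc c + (suc c + e)                   ≤⟨ m≤m+n _ (e + 2 * (c * e)) ⟩
      suc c + (suc c + e) + (e + 2 * (c * e)) ≡⟨ eq c e ⟩
      2 * suc c * suc e                     ∎
      where
      open ≤-Reasoning
      eq : ∀ c e → suc c + (suc c + e) + (e + 2 * (c * e)) ≡ 2 * suc c * suc e
      eq = solve-∀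

  -- With `M` written as `c v * W v`, this is `core` multiplied by `W v`.
  slack-eq : MaxClique L K → CliqueBound L → v ∈ L →
             M + length K * W v + slack K v ≡ 2 * M * nonNbrs K v
  slack-eq {K = K} {v} mx ub v∈ = m+[n∸m]≡n (begin
    M + length K * W v                     ≡⟨ cong (_+ length K * W v) (cW≡M v) ⟨
    c v * W v + length K * W v             ≡⟨ *-distribʳ-+ (W v) (c v) _ ⟨
    (c v + length K) * W v                 ≤⟨ *-monoˡ-≤ (W v) (core (0<c v) (1≤nonNbrs mx v∈) (length<c+nonNbrs (proj₁ mx) ub v∈)) ⟩
    2 * c v * nonNbrs K v * W v            ≡⟨ eq (c v) _ (W v) ⟩
    2 * (c v * W v) * nonNbrs K v          ≡⟨ cong (λ m → 2 * m * nonNbrs K v) (cW≡M v) ⟩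
    2 * M * nonNbrs K v                    ∎)
    where
    open ≤-Reasoning
    eq : ∀ c d w → 2 * c * d * w ≡ 2 * (c * w) * d
    eq = solve-∀

  -- Every `v` in `K` has c(v) ≥ |K|, so its weight is at most M / |K|.
  ∑W-clique : Clique L K → CliqueBound L → ∑ K W ≤ M
  ∑W-clique {K = []}        _  _  = z≤n
  ∑W-clique {K = K@(_ ∷ _)} cl ub = *-cancelˡ-≤ (length K) (begin
    length K * ∑ K W          ≡⟨ *-distribˡ-∑ K (length K) W ⟨
    ∑ K (λ v → length K * W v) ≤⟨ ∑-mono-≤ K (λ {v} v∈ → ≤-trans (*-monoˡ-≤ (W v) (ub K cl v∈)) (≤-reflexive (cW≡M v))) ⟩
    ∑ K (const M)             ≡⟨ ∑-const K M ⟩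
    length K * M              ∎)
    where open ≤-Reasoning

  -- Free of subtraction, this says that removing `K` lowers the defect M ne(L) - |L| ∑ W by at
  -- least the total slack of the vertices left. The only estimate in the calculation is
  -- `∑W-clique`; the rest is bookkeeping with `slack-eq`.
  peel : MaxClique L K → CliqueBound L → L ↭ K ++ L′ →
         length L * ∑ L W + ∑ L′ (slack K) + M * nonEdges L′ ≤ M * nonEdges L + length L′ * ∑ L′ W
  peel {L} {K} {L′} mx ub p = begin
    length L * ∑ L W + Δ + M * nonEdges L′
      ≡⟨ cong (λ x → x + Δ + M * nonEdges L′) (cong₂ _*_ (≡.trans (↭-length p) (length-++ K)) (≡.trans (∑-↭ W p) (∑-++ K L′ W))) ⟩
    (ω + n′) * (∑ K W + S′) + Δ + M * nonEdges L′
      ≤⟨ +-monoˡ-≤ _ (+-monoˡ-≤ _ (*-monoʳ-≤ (ω + n′) (+-monoˡ-≤ S′ (∑W-clique (proj₁ mx) ub)))) ⟩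
    (ω + n′) * (M + S′) + Δ + M * nonEdges L′
      ≡⟨ eq₁ ω n′ M S′ Δ (nonEdges L′) ⟩
    M * ω + (n′ * M + ω * S′ + Δ) + M * nonEdges L′ + n′ * S′
      ≡⟨ cong (λ x → M * ω + x + M * nonEdges L′ + n′ * S′) total ⟩
    M * ω + 2 * M * ∑ L′ (nonNbrs K) + M * nonEdges L′ + n′ * S′
      ≡⟨ eq₂ M ω (∑ L′ (nonNbrs K)) (nonEdges L′) (n′ * S′) ⟩
    M * (ω + 2 * ∑ L′ (nonNbrs K) + nonEdges L′) + n′ * S′
      ≡⟨ cong (λ x → M * x + n′ * S′) (≡.sym (≡.trans (nonEdges-↭ p) (≡.trans (nonEdges-++ K L′)
           (cong (λ x → x + 2 * ∑ L′ (nonNbrs K) + nonEdges L′) (nonEdges-clique (proj₁ (proj₁ mx))))))) ⟩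
    M * nonEdges L + n′ * S′ ∎
    where
    open ≤-Reasoning
    ω = length K
    n′ = length L′
    S′ = ∑ L′ W
    Δ = ∑ L′ (slack K)
    eq₁ : ∀ ω n M S Δ e → (ω + n) * (M + S) + Δ + M * e ≡ M * ω + (n * M + ω * S + Δ) + M * e + n * S
    eq₁ = solve-∀
    eq₂ : ∀ M ω d e x → M * ω + 2 * M * d + M * e + x ≡ M * (ω + 2 * d + e) + x
    eq₂ = solve-∀
    total : n′ * M + ω * S′ + Δ ≡ 2 * M * ∑ L′ (nonNbrs K)
    total = begin-equality
      n′ * M + ω * S′ + Δ
        ≡⟨ cong₂ (λ x y → x + y + Δ) (∑-const L′ M) (*-distribˡ-∑ L′ ω W) ⟨
      ∑ L′ (const M) + ∑ L′ (λ v → ω * W v) + Δ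
        ≡⟨ cong (_+ Δ) (∑-distrib-+ L′ _ _) ⟨
      ∑ L′ (λ v → M + ω * W v) + Δ
        ≡⟨ ∑-distrib-+ L′ _ _ ⟨
      ∑ L′ (λ v → M + ω * W v + slack K v)
        ≡⟨ ∑-cong L′ (λ v∈ → slack-eq mx ub (∈-resp-↭ (↭-sym p) (∈-++⁺ʳ K v∈))) ⟩
      ∑ L′ (λ v → 2 * M * nonNbrs K v)
        ≡⟨ *-distribˡ-∑ L′ (2 * M) _ ⟩
      2 * M * ∑ L′ (nonNbrs K) ∎

  ∑W≤nonEdges : CliqueBound L → length L * ∑ L W ≤ M * nonEdges L
  ∑W≤nonEdges {L} = go (length L) L ≤-refl
    where
    open ≤-Reasoning
    -- The rest `L′` is known only up to permutation, so the recursion runs on a bound for the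
    -- length.
    go : ∀ k L → length L ≤ k → CliqueBound L → length L * ∑ L W ≤ M * nonEdges L
    go _       []        _  _  = z≤n
    go (suc k) L@(x ∷ _) le ub with K , mx@((cl , sub) , max) ← maxClique L
                               with L′ , p ← split cl sub = +-cancelʳ-≤ (length L′ * ∑ L′ W) _ _ (begin
      length L * ∑ L W + length L′ * ∑ L′ W
        ≤⟨ +-monoʳ-≤ _ (go k L′ shorter (CliqueBound-⊆ (∈-resp-↭ (↭-sym p) ∘ ∈-++⁺ʳ K) ub)) ⟩
      length L * ∑ L W + M * nonEdges L′
        ≤⟨ +-monoˡ-≤ (M * nonEdges L′) (m≤m+n (length L * ∑ L W) (∑ L′ (slack K))) ⟩
      length L * ∑ L W + ∑ L′ (slack K) + M * nonEdges L′
        ≤⟨ peel mx ub p ⟩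
      M * nonEdges L + length L′ * ∑ L′ W ∎)
      where
      -- The singleton of `x` is a clique, so `K` is non-empty and the list really shrinks.
      shorter : length L′ ≤ k
      shorter = ≤-pred (begin
        1 + length L′         ≤⟨ +-monoˡ-≤ _ (max (x ∷ []) ([] ∷ [] , here refl ∷ [])) ⟩
        length K + length L′  ≡⟨ ≡.trans (↭-length p) (length-++ K) ⟨
        length L              ≤⟨ le ⟩
        suc k                 ∎)

  -- If the defect of `L` is below `m`, the slacks and the defect of `L′` share less than `m`.
  peel-< : ∀ {m} → MaxClique L K → CliqueBound L → L ↭ K ++ L′ → M * nonEdges L < length L * ∑ L W + m →
           ∑ L′ (slack K) + M * nonEdges L′ < m + length L′ * ∑ L′ W
  peel-< {L} {K} {L′} {m} mx ub p lt = +-cancelˡ-< (length L * ∑ L W) _ _ (begin-strict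
    length L * ∑ L W + (∑ L′ (slack K) + M * nonEdges L′)
      ≡⟨ +-assoc (length L * ∑ L W) _ _ ⟨
    length L * ∑ L W + ∑ L′ (slack K) + M * nonEdges L′
      ≤⟨ peel mx ub p ⟩
    M * nonEdges L + length L′ * ∑ L′ W
      <⟨ +-monoˡ-< _ lt ⟩
    length L * ∑ L W + m + length L′ * ∑ L′ W
      ≡⟨ +-assoc (length L * ∑ L W) m _ ⟩
    length L * ∑ L W + (m + length L′ * ∑ L′ W) ∎)
    where open ≤-Reasoning

  slack-< : ∀ {m} → MaxClique L K → CliqueBound L → L ↭ K ++ L′ → M * nonEdges L < length L * ∑ L W + m →
            ∑ L′ (slack K) < m
  slack-< {L} {K} {L′} {m} mx ub p lt = +-cancelʳ-< (M * nonEdges L′) _ _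
    (<-≤-trans (peel-< mx ub p lt)
      (+-monoʳ-≤ m (∑W≤nonEdges (CliqueBound-⊆ (∈-resp-↭ (↭-sym p) ∘ ∈-++⁺ʳ K) ub))))

-- Bijections of finite sets and invariance under isomorphism.

allFin-map-↭ : ∀ {m n} (f : Fin n → Fin m) → (∀ {u v} → f u ≡ f v → u ≡ v) → m ≤ n → allFin m ↭ map f (allFin n)
allFin-map-↭ {m} {n} f inj m≤n = Unique-⊆-full⇒↭
  (UniqueP.map⁺ inj (UniqueP.allFin⁺ n)) (All.tabulate λ _ → ∈-allFin _)
  (≤-trans (≤-reflexive (length-allFin m)) (≤-trans m≤n
    (≤-reflexive (≡.sym (≡.trans (length-map f (allFin n)) (length-allFin n))))))

injective⇒↔ : ∀ {m n} (f : Fin n → Fin m) → (∀ {u v} → f u ≡ f v → u ≡ v) → m ≤ n → Fin n ↔ Fin m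
injective⇒↔ f inj m≤n = mk↔ₛ′ f (proj₁ ∘ preimage) (≡.sym ∘ proj₂ ∘ preimage)
  (λ x → inj (≡.sym (proj₂ (preimage (f x)))))
  where
  preimage : ∀ y → ∃ λ x → y ≡ f x
  preimage y with x , _ , eq ← ∈-map⁻ f (∈-resp-↭ (allFin-map-↭ f inj m≤n) (∈-allFin y)) = x , eq

module _ {m n : ℕ} where

  ↔-injective : (f : Fin n ↔ Fin m) → ∀ {u v} → Inverse.to f u ≡ Inverse.to f v → u ≡ v
  ↔-injective f {u} {v} eq = ≡.trans (≡.sym (Inverse.strictlyInverseʳ f u))
    (≡.trans (cong (Inverse.from f) eq) (Inverse.strictlyInverseʳ f v))

  ∑-↔ : (f : Fin n ↔ Fin m) → ∀ g → ∑ (allFin n) (g ∘ Inverse.to f) ≡ ∑ (allFin m) g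
  ∑-↔ f g = ≡.trans (≡.sym (∑-map (allFin n) (Inverse.to f) g)) (≡.sym (∑-↭ g
    (allFin-map-↭ (Inverse.to f) (↔-injective f)
      (Fin.injective⇒≤ {f = Inverse.from f} λ {x} {y} eq →
        ≡.trans (≡.sym (Inverse.strictlyInverseˡ f x))
          (≡.trans (cong (Inverse.to f) eq) (Inverse.strictlyInverseˡ f y))))))

  open Peeling

  nonEdges-≅ : (G : Graph n) (H : Graph m) → G ≅ H → nonEdges G (allFin n) ≡ nonEdges H (allFin m)
  nonEdges-≅ G H (f , h) = ≡.trans
    (∑-cong (allFin n) λ {u} _ → ≡.trans
      (∑-cong (allFin n) λ {v} _ → cong (if_then 0 else 1) (≡.sym (h u v)))
      (∑-↔ f (nonadj H (Inverse.to f u))))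
    (∑-↔ f (nonNbrs H (allFin m)))

-- Residue classes and the exact count for Turán graphs.

∑-allFin-toℕ : ∀ n g → ∑ (allFin n) (g ∘ toℕ) ≡ ∑ (upTo n) g
∑-allFin-toℕ n g = cong sum (≡.trans (map-tabulate id (g ∘ toℕ)) (go n g id))
  where
  go : ∀ n g h → tabulate {n = n} (g ∘ h ∘ toℕ) ≡ map g (applyUpTo h n)
  go zero    g h = refl
  go (suc n) g h = cong (g (h 0) ∷_) (go n g (h ∘ suc))

∑-upTo-suc : ∀ n g → ∑ (upTo (suc n)) g ≡ ∑ (upTo n) g + g n
∑-upTo-suc n g = ≡.trans (cong (λ xs → ∑ xs g) (≡.sym (upTo-∷ʳ n)))
  (≡.trans (∑-++ (upTo n) (n ∷ []) g) (cong (∑ (upTo n) g +_) (+-identityʳ (g n))))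

≢⇒≡ᵇ-false : ∀ {a b} → a ≢ b → (a ≡ᵇ b) ≡ false
≢⇒≡ᵇ-false {a} {b} a≢b with a ≡ᵇ b in eq
... | false = refl
... | true  = contradiction (≡ᵇ⇒≡ a b (subst T (≡.sym eq) _)) a≢b

module Residues (k : ℕ) where

  private r = suc k

  [_≡_] [_<_] : ℕ → ℕ → ℕ
  [ a ≡ b ] = if a ≡ᵇ b then 1 else 0
  [ a < b ] = if a <ᵇ b then 1 else 0

  [≡]-sym : ∀ a b → [ a ≡ b ] ≡ [ b ≡ a ]
  [≡]-sym a b = cong (if_then 1 else 0) (≡ᵇ-sym a b)

  [≡]-refl : ∀ a → [ a ≡ a ] ≡ 1
  [≡]-refl a = cong (if_then 1 else 0) (≡ᵇ-refl a)

  [<]-suc : ∀ x s → [ x < s ] + [ s ≡ x ] ≡ [ x < suc s ]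
  [<]-suc zero    zero    = refl
  [<]-suc zero    (suc s) = refl
  [<]-suc (suc x) zero    = refl
  [<]-suc (suc x) (suc s) = [<]-suc x s

  [<]-irrefl : ∀ x → [ x < x ] ≡ 0
  [<]-irrefl zero    = refl
  [<]-irrefl (suc x) = [<]-irrefl x

  [<]-true : ∀ {x s} → x < s → [ x < s ] ≡ 1
  [<]-true {zero}  (s≤s _)  = refl
  [<]-true {suc x} (s≤s lt) = [<]-true lt

  classSize : ℕ → ℕ → ℕ
  classSize n x = ∑ (upTo n) λ a → [ a % r ≡ x ]

  congruentPairs : ℕ → ℕ
  congruentPairs n = ∑ (upTo n) λ a → classSize n (a % r)

  classSize-suc : ∀ n x → classSize (suc n) x ≡ classSize n x + [ n % r ≡ x ]
  classSize-suc n x = ∑-upTo-suc n _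

  -- The new element n pairs with each earlier element of its class in both orders, and once with
  -- itself.
  congruentPairs-suc : ∀ n → congruentPairs (suc n) ≡ congruentPairs n + 2 * classSize n (n % r) + 1
  congruentPairs-suc n = begin
    congruentPairs (suc n)
      ≡⟨ ∑-upTo-suc n _ ⟩
    ∑ (upTo n) (λ a → classSize (suc n) (a % r)) + classSize (suc n) (n % r)
      ≡⟨ cong₂ _+_ (≡.trans (∑-cong (upTo n) λ {a} _ → classSize-suc n (a % r)) (∑-distrib-+ (upTo n) _ _)) (classSize-suc n (n % r)) ⟩
    congruentPairs n + ∑ (upTo n) (λ a → [ n % r ≡ a % r ]) + (classSize n (n % r) + [ n % r ≡ n % r ])
      ≡⟨ cong₂ (λ x y → congruentPairs n + x + (classSize n (n % r) + y))
           (∑-cong (upTo n) λ {a} _ → [≡]-sym (n % r) (a % r)) ([≡]-refl (n % r)) ⟩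
    congruentPairs n + classSize n (n % r) + (classSize n (n % r) + 1)
      ≡⟨ eq (congruentPairs n) _ ⟩
    congruentPairs n + 2 * classSize n (n % r) + 1 ∎
    where
    open ≡-Reasoning
    eq : ∀ a b → a + b + (b + 1) ≡ a + 2 * b + 1
    eq = solve-∀

  -- The division n = q r + s and the class sizes are proved together by adding one vertex at a
  -- time. The field `pairs` is the sum of squares s (q + 1)² + (r - s) q² of the class sizes,
  -- multiplied by r and freed of q.
  record Count (n : ℕ) : Set where
    field
      q s   : ℕ
      n≡    : n ≡ s + q * r
      s<r   : s < r
      sizes : ∀ {x} → x < r → classSize n x ≡ q + [ x < s ]
      pairs : r * congruentPairs n + s * s ≡ n * n + s * r

    n%r≡s : n % r ≡ s
    n%r≡s = ≡.trans (cong (_% r) n≡) (≡.trans ([m+kn]%n≡m%n s q r) (m<n⇒m%n≡m s<r))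

  count : ∀ n → Count n
  count zero = record { q = 0 ; s = 0 ; n≡ = refl ; s<r = s≤s z≤n ; sizes = λ _ → refl
                      ; pairs = ≡.trans (+-identityʳ _) (*-zeroʳ r) }
  count (suc n) = next (m≤n⇒m<n∨m≡n s<r)
    where
    open Count (count n)
    sizes′ : ∀ {x} → x < r → classSize (suc n) x ≡ q + [ x < suc s ]
    sizes′ {x} x<r = ≡.trans (classSize-suc n x) (≡.trans
      (cong₂ _+_ (sizes x<r) (cong [_≡ x ] n%r≡s))
      (≡.trans (+-assoc q _ _) (cong (q +_) ([<]-suc x s))))
    pairs′ : r * congruentPairs (suc n) + suc s * suc s ≡ suc n * suc n + suc s * r
    pairs′ = begin
      r * congruentPairs (suc n) + suc s * suc s
        ≡⟨ cong (λ x → r * x + suc s * suc s) (≡.trans (congruentPairs-suc n)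
             (cong (λ x → congruentPairs n + 2 * x + 1) (≡.trans (cong (classSize n) n%r≡s)
               (≡.trans (sizes s<r) (≡.trans (cong (q +_) ([<]-irrefl s)) (+-identityʳ q)))))) ⟩
      r * (congruentPairs n + 2 * q + 1) + suc s * suc s
        ≡⟨ eq₁ r (congruentPairs n) q s ⟩
      r * congruentPairs n + s * s + (2 * (s + q * r) + r + 1)
        ≡⟨ cong₂ (λ x y → x + (2 * y + r + 1)) pairs (≡.sym n≡) ⟩
      n * n + s * r + (2 * n + r + 1)
        ≡⟨ eq₂ n s r ⟩
      suc n * suc n + suc s * r ∎
      where
      open ≡-Reasoning
      eq₁ : ∀ r c q s → r * (c + 2 * q + 1) + suc s * suc s ≡ r * c + s * s + (2 * (s + q * r) + r + 1)
      eq₁ = solve-∀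
      eq₂ : ∀ n s r → n * n + s * r + (2 * n + r + 1) ≡ suc n * suc n + suc s * r
      eq₂ = solve-∀
    next : suc s < r ⊎ suc s ≡ r → Count (suc n)
    next (inj₁ lt) = record { q = q ; s = suc s ; n≡ = cong suc n≡ ; s<r = lt ; sizes = sizes′ ; pairs = pairs′ }
    -- The last residue is reached: the remainder returns to 0, the quotient grows, and the terms r²
    -- in `pairs′` cancel.
    next (inj₂ eq) = record { q = suc q ; s = 0 ; n≡ = ≡.trans (cong suc n≡) (cong (_+ q * r) eq) ; s<r = s≤s z≤n
      ; sizes = λ {x} x<r → ≡.trans (sizes′ x<r) (≡.trans (cong (q +_) ([<]-true (subst (x <_) (≡.sym eq) x<r)))
          (≡.trans (+-comm q 1) (≡.sym (+-identityʳ (suc q)))))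
      ; pairs = ≡.trans (+-identityʳ _) (≡.trans (+-cancelʳ-≡ (r * r) _ _
          (≡.trans (cong (λ x → r * congruentPairs (suc n) + x * x) (≡.sym eq))
            (≡.trans pairs′ (cong (λ x → suc n * suc n + x * r) eq)))) (≡.sym (+-identityʳ _))) }

  module _ (n : ℕ) where

    turán-same : ∀ u v → toℕ u % r ≡ toℕ v % r → adj (turán n k) u v ≡ false
    turán-same u v eq = ≡.trans
      (cong (λ x → not (toℕ u ≡ᵇ toℕ v) ∧ (not x ∧ not (toℕ v % r ≡ᵇ toℕ u % r)))
        (≡.trans (cong (_≡ᵇ toℕ v % r) eq) (≡ᵇ-refl (toℕ v % r))))
      (∧-zeroʳ _)

    turán-diff : ∀ u v → toℕ u % r ≢ toℕ v % r → adj (turán n k) u v ≡ true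
    turán-diff u v ne = cong₂ (λ x y → not x ∧ y) (≢⇒≡ᵇ-false {toℕ u} {toℕ v} (ne ∘ cong (_% r)))
      (cong₂ (λ x y → not x ∧ not y) (≢⇒≡ᵇ-false ne) (≢⇒≡ᵇ-false (ne ∘ ≡.sym)))

    nonadj-turán : ∀ u v → Peeling.nonadj (turán n k) u v ≡ [ toℕ v % r ≡ toℕ u % r ]
    nonadj-turán u v with toℕ v % r ≟ toℕ u % r
    ... | yes eq = ≡.trans (Peeling.nonadj-¬adj (turán n k) {u} {v} (turán-same u v (≡.sym eq)))
                     (≡.sym (≡.trans (cong [_≡ toℕ u % r ] eq) ([≡]-refl (toℕ u % r))))
    ... | no  ne = ≡.trans (Peeling.nonadj-adj (turán n k) {u} {v} (turán-diff u v (ne ∘ ≡.sym)))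
                     (≡.sym (cong (if_then 1 else 0) (≢⇒≡ᵇ-false ne)))

    nonEdges-turán : r * Peeling.nonEdges (turán n k) (allFin n) + n % r * (n % r) ≡ n * n + n % r * r
    nonEdges-turán = subst (λ s → r * Peeling.nonEdges (turán n k) (allFin n) + s * s ≡ n * n + s * r) (≡.sym n%r≡s)
      (≡.trans (cong (λ x → r * x + s * s) eq) pairs)
      where
      open Count (count n)
      eq : Peeling.nonEdges (turán n k) (allFin n) ≡ congruentPairs n
      eq = ≡.trans (∑-cong (allFin n) λ {u} _ → ≡.trans (∑-cong (allFin n) λ {v} _ → nonadj-turán u v)
                     (∑-allFin-toℕ n (λ b → [ b % r ≡ toℕ u % r ])))
                   (∑-allFin-toℕ n (λ a → classSize n (a % r)))

  private
    2r+rt : ∀ r t → 2 * r + r * t ≡ suc (suc t) * r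
    2r+rt = solve-∀

  -- T(n, r) falls short of the bound n² (r - 1) / 2r by s (r - s) / 2r.
  deficiency-<⇒ : ∀ {s} → s * r < s * s + 2 * r → (s ≤ 2) ⊎ (r * (s ∸ 2) < s * s)
  deficiency-<⇒ {0} _ = inj₁ z≤n
  deficiency-<⇒ {1} _ = inj₁ (s≤s z≤n)
  deficiency-<⇒ {s@(suc (suc t))} lt = inj₂ (+-cancelˡ-< (2 * r) _ _ (begin-strict
    2 * r + r * t  ≡⟨ 2r+rt r t ⟩
    s * r          <⟨ lt ⟩
    s * s + 2 * r  ≡⟨ +-comm (s * s) _ ⟩
    2 * r + s * s  ∎))
    where open ≤-Reasoning

  ⇒deficiency-< : ∀ {s} → (s ≤ 2) ⊎ (r * (s ∸ 2) < s * s) → s * r < s * s + 2 * r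
  ⇒deficiency-< {0} _ = s≤s z≤n
  ⇒deficiency-< {1} _ = s≤s (*-monoˡ-≤ r {1} {2} (s≤s z≤n))
  ⇒deficiency-< {2} _ = m<n+m (2 * r) {4} (s≤s z≤n)
  ⇒deficiency-< {suc (suc (suc t))} (inj₁ (s≤s (s≤s ())))
  ⇒deficiency-< {s@(suc (suc t))} (inj₂ lt) = begin-strict
    s * r          ≡⟨ 2r+rt r t ⟨
    2 * r + r * t  <⟨ +-monoʳ-< (2 * r) lt ⟩
    2 * r + s * s  ≡⟨ +-comm (2 * r) _ ⟩
    s * s + 2 * r  ∎
    where open ≤-Reasoning

-- Isomorphisms from explicit vertex lists, and Turán's bound.

≅-lookup : ∀ {n} (G : Graph n) xs → allFin n ↭ xs → (H : Graph (length xs)) →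
           AllPairs (λ i j → adj G (lookup xs i) (lookup xs j) ≡ adj H i j) (allFin (length xs)) → G ≅ H
≅-lookup {n} G xs p H agree = ↔-sym g , λ u v → ≡.trans (≡.sym (agree′ _ _))
    (cong₂ (adj G) (Inverse.strictlyInverseˡ g u) (Inverse.strictlyInverseˡ g v))
  where
  lookup-injective : ∀ {ys : List (Fin n)} → Unique ys → ∀ {i j} → lookup ys i ≡ lookup ys j → i ≡ j
  lookup-injective (_ ∷ _) {zero}  {zero}  _  = refl
  lookup-injective (x∉ ∷ _) {zero}  {suc j} eq = contradiction eq (All.lookup x∉ (∈-lookup j))
  lookup-injective (x∉ ∷ _) {suc i} {zero}  eq = contradiction (≡.sym eq) (All.lookup x∉ (∈-lookup i))
  lookup-injective (_ ∷ u) {suc i} {suc j} eq = cong suc (lookup-injective u eq)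
  g : Fin (length xs) ↔ Fin n
  g = injective⇒↔ (lookup xs) (lookup-injective (AllPairs-resp-↭ (_∘ ≡.sym) p (UniqueP.allFin⁺ n)))
    (≤-reflexive (≡.trans (≡.sym (length-allFin n)) (↭-length p)))
  -- The hypothesis treats each pair of positions in one order; symmetry and irreflexivity supply
  -- the others.
  agree′ : ∀ i j → adj G (lookup xs i) (lookup xs j) ≡ adj H i j
  agree′ i j with ∈-AllPairs₂ agree (∈-allFin i) (∈-allFin j)
  ... | inj₁ refl        = ≡.trans (irrefl G _) (≡.sym (irrefl H i))
  ... | inj₂ (inj₁ eq)   = eq
  ... | inj₂ (inj₂ eq)   = ≡.trans (Graph.sym G _ _) (≡.trans eq (Graph.sym H j i))

-- The weighted inequality with `c` constantly `t`, M = t and W = 1. The entries of `L` may repeat,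
-- which `classSize-balanced` exploits.
turán-bound : ∀ {n} (G : Graph n) {t L} → 0 < t → (∀ K → Peeling.Clique G L K → length K ≤ t) →
              length L * length L ≤ t * Peeling.nonEdges G L
turán-bound G {t} {L} t>0 max = ≤-trans
  (≤-reflexive (cong (length L *_) (≡.sym (≡.trans (∑-const L 1) (*-identityʳ _)))))
  (Weighted.∑W≤nonEdges G t t>0 (const t) (const 1) (λ _ → *-identityʳ t) λ K cl _ → max K cl)

-- Local structure of graphs that attain the bound.

module Tight {n : ℕ} (G : Graph n) (M : ℕ) (M>0 : 0 < M) (c W : Fin n → ℕ) (cW≡M : ∀ v → c v * W v ≡ M)
             (cliqueNumber : ∀ v → IsVertexCliqueNumber G v (c v))
             (tight : M * Peeling.nonEdges G (allFin n) < length (allFin n) * ∑ (allFin n) W + 2 * M) where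

  open Peeling G
  open Weighted G M M>0 c W cW≡M

  private variable
    u v w : Fin n
    K L L′ : List (Fin n)

  V : List (Fin n)
  V = allFin n

  ⊆V : ∀ K → All (_∈ V) K
  ⊆V K = All.tabulate λ _ → ∈-allFin _

  V-bound : CliqueBound V
  V-bound K (cl , _) v∈ = proj₂ (cliqueNumber _) K cl v∈

  c≤length : MaxClique V K → ∀ v → c v ≤ length K
  c≤length (_ , max) v with K′ , cl , _ , eq ← proj₁ (cliqueNumber v) = subst (_≤ _) eq (max K′ (cl , ⊆V K′))

  private
    -- Put ω = c + δ and d = δ + 1 + e. The last hypothesis becomes 2c(δ + 1 + e) < 4c + δ, which
    -- fails for e ≥ 1, and for e = 0 as soon as δ ≥ 2. This leaves e = 0 with δ = 0 or δ = 1.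
    tightArith : ∀ {c ω d} → 0 < c → c ≤ ω → ω < c + d → 2 * c * d < 3 * c + ω →
                 c + d ≡ suc ω × (c ≡ ω ⊎ suc c ≡ ω)
    tightArith {suc b} {ω} {d} _ c≤ω ω<c+d lt
      with δ , refl ← m≤n⇒∃[o]m+o≡n c≤ω
      with e , refl ← m≤n⇒∃[o]m+o≡n (+-cancelˡ-≤ (suc b) _ _ (≤-trans (≤-reflexive (+-suc (suc b) δ)) ω<c+d)) = go δ e lt
      where
      open ≤-Reasoning
      go : ∀ δ e → 2 * suc b * (suc δ + e) < 3 * suc b + (suc b + δ) →
           suc b + (suc δ + e) ≡ suc (suc b + δ) × (suc b ≡ suc b + δ ⊎ suc (suc b) ≡ suc b + δ)
      go 0 0 _ = +-suc (suc b) 0 , inj₁ (≡.sym (+-identityʳ _))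
      go 1 0 _ = +-suc (suc b) 1 , inj₂ (≡.sym (+-comm (suc b) 1))
      go (suc (suc δ)) 0 lt = contradiction lt (≤⇒≯ (begin
        3 * suc b + (suc b + suc (suc δ))                           ≤⟨ m≤m+n _ (2 * b + δ + 2 * (b * δ)) ⟩
        3 * suc b + (suc b + suc (suc δ)) + (2 * b + δ + 2 * (b * δ)) ≡⟨ eq b δ ⟩
        2 * suc b * (suc (suc (suc δ)) + 0)                         ∎))
        where
        eq : ∀ b δ → 3 * suc b + (suc b + suc (suc δ)) + (2 * b + δ + 2 * (b * δ)) ≡ 2 * suc b * (suc (suc (suc δ)) + 0)
        eq = solve-∀
      go δ (suc e) lt = contradiction lt (≤⇒≯ (begin
        3 * suc b + (suc b + δ)                                      ≤⟨ m≤m+n _ (δ + 2 * (b * δ) + 2 * (suc b * e)) ⟩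
        3 * suc b + (suc b + δ) + (δ + 2 * (b * δ) + 2 * (suc b * e)) ≡⟨ eq b δ e ⟩
        2 * suc b * (suc δ + suc e)                                  ∎))
        where
        eq : ∀ b δ e → 3 * suc b + (suc b + δ) + (δ + 2 * (b * δ) + 2 * (suc b * e)) ≡ 2 * suc b * (suc δ + suc e)
        eq = solve-∀

  -- One slack is below 2M because their sum is; divided by `W v`, this is the last hypothesis of
  -- `tightArith`.
  tight-vertex : MaxClique V K → V ↭ K ++ L′ → v ∈ L′ →
                 c v + nonNbrs K v ≡ suc (length K) × (c v ≡ length K ⊎ suc (c v) ≡ length K)
  tight-vertex {K} {L′} {v} mx p v∈ = tightArith (0<c v) (c≤length mx v)
    (length<c+nonNbrs (proj₁ mx) V-bound (∈-allFin v))
    (*-cancelʳ-< (W v) _ _ (begin-strict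
      2 * c v * d * W v                  ≡⟨ eq₁ (c v) d (W v) ⟩
      2 * (c v * W v) * d                ≡⟨ cong (λ m → 2 * m * d) (cW≡M v) ⟩
      2 * M * d                          ≡⟨ slack-eq mx V-bound (∈-allFin v) ⟨
      M + length K * W v + slack K v     <⟨ +-monoʳ-< _ (≤-<-trans (∈⇒≤∑ (slack K) v∈) (slack-< mx V-bound p tight)) ⟩
      M + length K * W v + 2 * M         ≡⟨ cong (λ m → m + length K * W v + 2 * m) (cW≡M v) ⟨
      c v * W v + length K * W v + 2 * (c v * W v) ≡⟨ eq₂ (c v) (length K) (W v) ⟩
      (3 * c v + length K) * W v         ∎))
    where
    open ≤-Reasoning
    d = nonNbrs K v
    eq₁ : ∀ c d w → 2 * c * d * w ≡ 2 * (c * w) * d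
    eq₁ = solve-∀
    eq₂ : ∀ c ω w → c * w + ω * w + 2 * (c * w) ≡ (3 * c + ω) * w
    eq₂ = solve-∀

  -- Constant clique number: Turán graphs.

  module Regular (ω : ℕ) (ω>0 : 0 < ω) (c≡ω : ∀ v → c v ≡ ω) where

    clique≤ω : IsClique G K → length K ≤ ω
    clique≤ω {[]}    _  = z≤n
    clique≤ω {x ∷ K} cl = ≤-trans (proj₂ (cliqueNumber x) _ cl (here refl)) (≤-reflexive (c≡ω x))

    -- A vertex of `K` misses only itself; for a vertex outside `K`, `tight-vertex` gives ω + d = ω
    -- + 1.
    nonNbrs≡1 : IsClique G K → length K ≡ ω → ∀ v → nonNbrs K v ≡ 1
    nonNbrs≡1 {K} cl eq v with L′ , p ← split cl (⊆V K) with ∈-++⁻ K (∈-resp-↭ p (∈-allFin v))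
    ... | inj₁ v∈K  = nonNbrs-clique cl v∈K
    ... | inj₂ v∈L′ = +-cancelˡ-≡ ω _ _ (≡.trans
      (subst (λ c → c + nonNbrs K v ≡ suc (length K)) (c≡ω v)
        (proj₁ (tight-vertex ((cl , ⊆V K) , λ K′ (cl′ , _) → ≤-trans (clique≤ω cl′) (≤-reflexive (≡.sym eq))) p v∈L′)))
      (≡.trans (cong suc eq) (+-comm 1 ω)))

    -- Exchanging u for v in a maximum clique through u gives another one; w misses only v in it, so w could join the first.
    nonadj-trans : adj G u v ≡ false → adj G v w ≡ false → adj G u w ≡ false
    nonadj-trans {u} {v} {w} uv vw with adj G u w in uw
    ... | false = refl
    ... | true with K , cl , u∈ , len ← proj₁ (cliqueNumber u)
               with K₀ , p ← ∈⇒↭ u∈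
               with uK₀ ∷ cl₀ ← AllPairs-resp-↭ adj-sym p cl =
      contradiction (clique≤ω ((adj-sym uw ∷ wK₀) ∷ uK₀ ∷ cl₀)) (<⇒≱ (≤-reflexive (cong suc (≡.sym len₀))))
      where
      len₀ : suc (length K₀) ≡ ω
      len₀ = ≡.trans (≡.sym (↭-length p)) (≡.trans len (c≡ω u))
      others : ∀ {x y} → All (λ z → adj G x z ≡ true) K₀ → adj G y x ≡ false → All (λ z → adj G y z ≡ true) K₀
      others {x} {y} xK₀ yx = nonNbrs≡0⁻ K₀ (suc-injective (≡.trans
        (cong (_+ nonNbrs K₀ y) (≡.sym (nonadj-¬adj {y} {x} yx)))
        (nonNbrs≡1 (xK₀ ∷ cl₀) len₀ y)))
      wK₀ : All (λ z → adj G w z ≡ true) K₀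
      wK₀ = others (others uK₀ (≡.trans (Graph.sym G v u) uv)) (≡.trans (Graph.sym G w v) vw)

    nonadj⇒twins : adj G u v ≡ false → ∀ w → adj G u w ≡ adj G v w
    nonadj⇒twins {u} {v} uv w with adj G u w in uw
    ... | false = ≡.sym (nonadj-trans (≡.trans (Graph.sym G v u) uv) uw)
    ... | true with adj G v w in vw
    ...   | true  = refl
    ...   | false = ≡.trans (≡.sym uw) (nonadj-trans uv vw)

    -- By `nonadj-trans` non-adjacency is an equivalence relation, and the non-neighbours of a
    -- vertex, itself included, are its class.
    classSize : Fin n → ℕ
    classSize = nonNbrs V

    classSize-cong : adj G u v ≡ false → classSize u ≡ classSize v
    classSize-cong uv = ∑-cong V λ {w} _ → cong (if_then 0 else 1) (nonadj⇒twins uv w)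

    ω*nonEdges< : ω * nonEdges V < length V * length V + 2 * ω
    ω*nonEdges< = *-cancelˡ-< M _ _ (begin-strict
      M * (ω * nonEdges V)                   ≡⟨ eq₁ M ω (nonEdges V) ⟩
      ω * (M * nonEdges V)                   <⟨ *-monoʳ-< ω {{ω≢0}} tight ⟩
      ω * (length V * ∑ V W + 2 * M)         ≡⟨ eq₂ ω (length V) (∑ V W) M ⟩
      length V * (ω * ∑ V W) + M * (2 * ω)   ≡⟨ cong (λ x → length V * x + M * (2 * ω)) ω∑W ⟩
      length V * (length V * M) + M * (2 * ω) ≡⟨ eq₃ (length V) M ω ⟩
      M * (length V * length V + 2 * ω)      ∎)
      where
      open ≤-Reasoning
      eq₁ : ∀ M ω e → M * (ω * e) ≡ ω * (M * e)
      eq₁ = solve-∀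
      eq₂ : ∀ ω n S M → ω * (n * S + 2 * M) ≡ n * (ω * S) + M * (2 * ω)
      eq₂ = solve-∀
      eq₃ : ∀ n M ω → n * (n * M) + M * (2 * ω) ≡ M * (n * n + 2 * ω)
      eq₃ = solve-∀
      ω∑W : ω * ∑ V W ≡ length V * M
      ω∑W = ≡.trans (≡.sym (*-distribˡ-∑ V ω W))
        (≡.trans (∑-cong V λ {v} _ → ≡.trans (cong (_* W v) (≡.sym (c≡ω v))) (cW≡M v)) (∑-const V M))
      ω≢0 : NonZero ω
      ω≢0 = >-nonZero ω>0

    -- Replacing u by a twin of v removes at least 2 (classSize u - classSize v - 1) non-adjacent ordered
    -- pairs and creates no larger clique, so the Turán bound for the new list limits the difference.
    classSize-balanced : ∀ u v → classSize u ≤ suc (classSize v)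
    classSize-balanced u v with L₀ , p ← ∈⇒↭ (∈-allFin u) = ≮⇒≥ λ lt → <⇒≱ ω*nonEdges< (begin
      length V * length V + 2 * ω
        ≡⟨ cong (λ x → x * x + 2 * ω) (↭-length p) ⟩
      length (v ∷ L₀) * length (v ∷ L₀) + 2 * ω
        ≤⟨ +-monoˡ-≤ (2 * ω) (turán-bound G {L = v ∷ L₀} ω>0 λ K (cl , _) → clique≤ω cl) ⟩
      ω * nonEdges (v ∷ L₀) + 2 * ω
        ≡⟨ cong (λ x → ω * x + 2 * ω) (nonEdges-∷ v L₀) ⟩
      ω * (1 + 2 * nonNbrs L₀ v + nonEdges L₀) + 2 * ω
        ≡⟨ eq ω (nonNbrs L₀ v) (nonEdges L₀) ⟩
      ω * (1 + 2 * suc (nonNbrs L₀ v) + nonEdges L₀)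
        ≤⟨ *-monoʳ-≤ ω (+-monoˡ-≤ (nonEdges L₀) (+-monoʳ-≤ 1 (*-monoʳ-≤ 2 (≤-pred (begin
          suc (suc (nonNbrs L₀ v))           ≤⟨ s≤s (s≤s (m≤n+m _ (nonadj v u))) ⟩
          suc (suc (nonNbrs (u ∷ L₀) v))     ≡⟨ cong (2 +_) (∑-↭ (nonadj v) p) ⟨
          suc (suc (classSize v))            ≤⟨ lt ⟩
          classSize u                        ≡⟨ ∑-↭ (nonadj u) p ⟩
          nonadj u u + nonNbrs L₀ u          ≡⟨ cong (_+ nonNbrs L₀ u) (nonadj-refl u) ⟩
          suc (nonNbrs L₀ u)                 ∎))))) ⟩
      ω * (1 + 2 * nonNbrs L₀ u + nonEdges L₀)
        ≡⟨ cong (ω *_) (≡.sym (≡.trans (nonEdges-↭ p) (nonEdges-∷ u L₀))) ⟩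
      ω * nonEdges V ∎)
      where
      open ≤-Reasoning
      eq : ∀ ω d e → ω * (1 + 2 * d + e) + 2 * ω ≡ ω * (1 + 2 * suc d + e)
      eq = solve-∀

    -- The position, from 0, of the first entry that `v` misses. The entries of a maximum clique
    -- represent the classes.
    classIndex : List (Fin n) → Fin n → ℕ
    classIndex []      v = 0
    classIndex (k ∷ K) v = if adj G v k then suc (classIndex K v) else 0

    classIndex< : ∀ K v → 0 < nonNbrs K v → classIndex K v < length K
    classIndex< (k ∷ K) v hit with adj G v k
    ... | true  = s≤s (classIndex< K v hit)
    ... | false = s≤s z≤n

    classIndex-cong : ∀ K → adj G u v ≡ false → classIndex K u ≡ classIndex K v
    classIndex-cong         []      uv = refl
    classIndex-cong {u} {v} (k ∷ K) uv with adj G u k | adj G v k | nonadj⇒twins uv k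
    ... | true  | true  | _ = cong suc (classIndex-cong K uv)
    ... | false | false | _ = refl

    classIndex-injective : ∀ K → 0 < nonNbrs K u → classIndex K u ≡ classIndex K v → adj G u v ≡ false
    classIndex-injective {u} {v} (k ∷ K) hit eq with adj G u k in uk | adj G v k in vk
    ... | true  | true  = classIndex-injective K hit (suc-injective eq)
    ... | false | false = nonadj-trans uk (≡.trans (Graph.sym G k v) vk)

    -- By `classSize-balanced` every class has at least ρ members. Each class up to that of `v`, at
    -- position i, has at least ρ + 1, since `K` lists the classes by decreasing size. The positions
    -- 0, ..., i thus contribute i + 1 beyond ρ |K|.
    classIndex-room : ∀ K → AllPairs (λ k l → classSize l ≤ classSize k) K → ∀ v ρ → ρ < classSize v →
                      0 < nonNbrs K v → ρ * length K + classIndex K v < ∑ K classSize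
    classIndex-room K sorted v ρ ρ< = go K sorted
      where
      open ≤-Reasoning
      ρ≤ : ∀ k → ρ ≤ classSize k
      ρ≤ k = ≤-pred (≤-trans ρ< (classSize-balanced v k))
      rearrange : ∀ ρ l i → ρ * suc l + i ≡ ρ + (ρ * l + i)
      rearrange = solve-∀
      -- Some entry of `K` is missed by `v` and so lies in its class; a bound for all entries
      -- therefore applies to `v`.
      reach : ∀ K {m} → All (λ l → classSize l ≤ m) K → 0 < nonNbrs K v → classSize v ≤ m
      reach (k ∷ K) (le ∷ les) hit with adj G v k in vk
      ... | true  = reach K les hit
      ... | false = ≤-trans (≤-reflexive (classSize-cong vk)) le
      go : ∀ K → AllPairs (λ k l → classSize l ≤ classSize k) K → 0 < nonNbrs K v →
           ρ * length K + classIndex K v < ∑ K classSize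
      go (k ∷ K) (le ∷ sorted) hit with adj G v k in vk
      ... | true  = begin-strict
        ρ * suc (length K) + suc (classIndex K v)   ≡⟨ rearrange ρ (length K) _ ⟩
        ρ + (ρ * length K + suc (classIndex K v))   ≡⟨ cong (ρ +_) (+-suc (ρ * length K) _) ⟩
        ρ + suc (ρ * length K + classIndex K v)     <⟨ +-mono-<-≤ (≤-trans ρ< (reach K le hit)) (go K sorted hit) ⟩
        classSize k + ∑ K classSize                 ∎
      ... | false = begin-strict
        ρ * suc (length K) + 0                      ≡⟨ rearrange ρ (length K) 0 ⟩
        ρ + (ρ * length K + 0)                      ≡⟨ cong (ρ +_) (≡.trans (+-identityʳ _) (*-comm ρ (length K))) ⟩
        ρ + length K * ρ                            <⟨ +-mono-<-≤ (≤-trans ρ< (≤-reflexive (classSize-cong vk)))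
                                                         (≤-trans (≤-reflexive (≡.sym (∑-const K ρ))) (∑-mono-≤ K λ {l} _ → ρ≤ l)) ⟩
        classSize k + ∑ K classSize                 ∎

    -- Double counting: every vertex misses exactly one entry of `K`.
    ∑-classSize : IsClique G K → length K ≡ ω → ∑ K classSize ≡ n
    ∑-classSize {K} cl len = begin
      ∑ K (λ k → ∑ V (nonadj k))              ≡⟨ ∑-comm K V nonadj ⟩
      ∑ V (λ v → ∑ K (λ k → nonadj k v))      ≡⟨ ∑-cong V (λ {v} _ → ≡.trans (∑-cong K λ {k} _ → nonadj-sym k v) (nonNbrs≡1 cl len v)) ⟩
      ∑ V (const 1)                           ≡⟨ ∑-const V 1 ⟩
      length V * 1                            ≡⟨ *-identityʳ _ ⟩
      length V                                ≡⟨ length-allFin n ⟩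
      n                                       ∎
      where open ≡-Reasoning

    earlier : Fin n → Fin n → ℕ
    earlier v u = if toℕ u <ᵇ toℕ v then nonadj v u else 0

    -- Numbers the vertices within each class from 0, in the order of `Fin n`.
    rank : Fin n → ℕ
    rank v = ∑ V (earlier v)

    private
      earlier-yes : ∀ {u v} → toℕ u < toℕ v → earlier v u ≡ nonadj v u
      earlier-yes {u} {v} lt with toℕ u <ᵇ toℕ v in eq
      ... | true  = refl
      ... | false = contradiction (<⇒<ᵇ lt) (subst T eq)

      earlier-no : ∀ {u v} → ¬ (toℕ u < toℕ v) → earlier v u ≡ 0
      earlier-no {u} {v} ≮ with toℕ u <ᵇ toℕ v in eq
      ... | false = refl
      ... | true  = contradiction (<ᵇ⇒< (toℕ u) (toℕ v) (subst T (≡.sym eq) _)) ≮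

      earlier≤ : ∀ v u → earlier v u ≤ nonadj v u
      earlier≤ v u with toℕ u <ᵇ toℕ v
      ... | true  = ≤-refl
      ... | false = z≤n

    rank< : ∀ v → rank v < classSize v
    rank< v = ∑-mono-< V (λ {u} _ → earlier≤ v u) (∈-allFin v) (begin-strict
      earlier v v  ≡⟨ earlier-no {v} {v} (<-irrefl refl) ⟩
      0            <⟨ s≤s z≤n ⟩
      1            ≡⟨ nonadj-refl v ⟨
      nonadj v v   ∎)
      where open ≤-Reasoning

    rank-mono : adj G u v ≡ false → toℕ u < toℕ v → rank u < rank v
    rank-mono {u} {v} uv u<v = ∑-mono-< V (λ {w} _ → le w) (∈-allFin u) (begin-strict
      earlier u u  ≡⟨ earlier-no {u} {u} (<-irrefl refl) ⟩
      0            <⟨ s≤s z≤n ⟩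
      1            ≡⟨ nonadj-¬adj {v} {u} (≡.trans (Graph.sym G v u) uv) ⟨
      nonadj v u   ≡⟨ earlier-yes u<v ⟨
      earlier v u  ∎)
      where
      open ≤-Reasoning
      le : ∀ w → earlier u w ≤ earlier v w
      le w with toℕ w <? toℕ u
      ... | no  w≮u = ≤-trans (≤-reflexive (earlier-no {w} {u} w≮u)) z≤n
      ... | yes w<u = ≤-reflexive (≡.trans (earlier-yes w<u) (≡.trans
        (cong (if_then 0 else 1) (nonadj⇒twins uv w)) (≡.sym (earlier-yes (<-trans w<u u<v)))))

    rank-injective : adj G u v ≡ false → rank u ≡ rank v → u ≡ v
    rank-injective {u} {v} uv eq with <-cmp (toℕ u) (toℕ v)
    ... | tri< u<v _ _ = contradiction eq (<⇒≢ (rank-mono uv u<v))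
    ... | tri≈ _ u≡v _ = Fin.toℕ-injective u≡v
    ... | tri> _ _ v<u = contradiction (≡.sym eq) (<⇒≢ (rank-mono (≡.trans (Graph.sym G v u) uv) v<u))

    -- The i-th largest class is sent to the residue class of i modulo r, in increasing order.
    ≅-turán : ∀ k → ω ≡ suc k → ∀ K → IsClique G K → length K ≡ ω →
              AllPairs (λ k l → classSize l ≤ classSize k) K → G ≅ turán n k
    ≅-turán k refl K cl len sorted = injective⇒↔ F F-injective ≤-refl , F-adj
      where
      open Residues k using (turán-same; turán-diff)
      hit : ∀ v → 0 < nonNbrs K v
      hit v = ≤-reflexive (≡.sym (nonNbrs≡1 cl len v))
      f : Fin n → ℕ
      f v = classIndex K v + rank v * suc k
      f<n : ∀ v → f v < n
      f<n v = begin-strict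
        classIndex K v + rank v * suc k       ≡⟨ +-comm (classIndex K v) _ ⟩
        rank v * suc k + classIndex K v       ≡⟨ cong (λ x → rank v * x + classIndex K v) len ⟨
        rank v * length K + classIndex K v    <⟨ classIndex-room K sorted v (rank v) (rank< v) (hit v) ⟩
        ∑ K classSize                         ≡⟨ ∑-classSize cl len ⟩
        n                                     ∎
        where open ≤-Reasoning
      F : Fin n → Fin n
      F v = fromℕ< (f<n v)
      f% : ∀ v → f v % suc k ≡ classIndex K v
      f% v = ≡.trans ([m+kn]%n≡m%n (classIndex K v) (rank v) (suc k))
        (m<n⇒m%n≡m (subst (classIndex K v <_) len (classIndex< K v (hit v))))
      F% : ∀ v → toℕ (F v) % suc k ≡ classIndex K v
      F% v = ≡.trans (cong (_% suc k) (Fin.toℕ-fromℕ< (f<n v))) (f% v)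
      F-injective : ∀ {u v} → F u ≡ F v → u ≡ v
      F-injective {u} {v} eq = rank-injective (classIndex-injective K (hit u) same) (*-cancelʳ-≡ (rank u) (rank v) (suc k)
        (+-cancelˡ-≡ (classIndex K u) _ _ (≡.trans feq (cong (_+ rank v * suc k) (≡.sym same)))))
        where
        feq : f u ≡ f v
        feq = ≡.trans (≡.sym (Fin.toℕ-fromℕ< (f<n u))) (≡.trans (cong toℕ eq) (Fin.toℕ-fromℕ< (f<n v)))
        same : classIndex K u ≡ classIndex K v
        same = ≡.trans (≡.sym (f% u)) (≡.trans (cong (_% suc k) feq) (f% v))
      F-adj : ∀ u v → adj (turán n k) (F u) (F v) ≡ adj G u v
      F-adj u v with adj G u v in uv
      ... | false = turán-same n (F u) (F v) (≡.trans (F% u) (≡.trans (classIndex-cong K uv) (≡.sym (F% v))))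
      ... | true  = turán-diff n (F u) (F v) λ eq → Bool-absurd
        (classIndex-injective K (hit u) (≡.trans (≡.sym (F% u)) (≡.trans eq (F% v)))) uv
        where
        Bool-absurd : ∀ {b} → b ≡ false → b ≢ true
        Bool-absurd refl ()

    -- Once G is known to be a Turán graph, its exact count of non-adjacent pairs turns
    -- `ω*nonEdges<` into s r < s² + 2 r, the condition in `InS`.
    regular⇒InS : ∀ K → IsClique G K → length K ≡ ω → InS G
    regular⇒InS K cl len = go ω refl
      where
      -- The order is flipped, so that sorting puts the largest classes first.
      open Sort (On.decTotalOrder (Flip.decTotalOrder ≤-decTotalOrder) classSize)
      open ≤-Reasoning
      go : ∀ r → ω ≡ r → InS G
      go zero    eq = contradiction eq (>⇒≢ ω>0)
      go (suc k) eq = k , deficiency-<⇒ {n % suc k} (+-cancelˡ-< (n * n) _ _ (begin-strict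
          n * n + n % r * r                                      ≡⟨ nonEdges-turán n ⟨
          r * Peeling.nonEdges (turán n k) (allFin n) + n % r * (n % r)
            ≡⟨ cong₂ (λ x y → x * y + n % r * (n % r)) eq (nonEdges-≅ G (turán n k) iso) ⟨
          ω * nonEdges V + n % r * (n % r)                       <⟨ +-monoˡ-< _ ω*nonEdges< ⟩
          length V * length V + 2 * ω + n % r * (n % r)
            ≡⟨ cong₂ (λ x y → x * x + 2 * y + n % r * (n % r)) (length-allFin n) eq ⟩
          n * n + 2 * r + n % r * (n % r)                        ≡⟨ assoc (n * n) (2 * r) _ ⟩
          n * n + (n % r * (n % r) + 2 * r)                      ∎)) , iso
        where
        r = suc k
        open Residues k
        assoc : ∀ a b c → a + b + c ≡ a + (c + b)
        assoc = solve-∀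
        iso : G ≅ turán n k
        iso = ≅-turán k eq (sort K) (AllPairs-resp-↭ adj-sym (↭-sym (sort-↭ K)) cl)
          (≡.trans (↭-length (sort-↭ K)) len)
          (Linked.Linked⇒AllPairs (λ ij jk → ≤-trans jk ij) (sort-↗ K))

  -- An exceptional vertex: the graphs X and Y.

  low-slack : MaxClique L K → CliqueBound L → v ∈ L → suc (c v) ≡ length K → 2 * M ≤ slack K v + W v
  -- From c + 1 = ω and ω < c + d follows d ≥ 2. Since ω W(v) = M + W(v), the slack is at least 4M -
  -- M - (M + W(v)).
  low-slack {L} {K} {v} mx ub v∈ eq = +-cancelˡ-≤ (2 * M) _ _ (begin
    2 * M + 2 * M                       ≡⟨ eq₁ M ⟩
    2 * M * 2                           ≤⟨ *-monoʳ-≤ (2 * M) (+-cancelˡ-≤ (c v) _ _ (≤-trans (≤-reflexive (≡.trans (+-comm (c v) 2) (cong suc eq)))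
                                             (length<c+nonNbrs (proj₁ mx) ub v∈))) ⟩
    2 * M * nonNbrs K v                 ≡⟨ slack-eq mx ub v∈ ⟨
    M + length K * W v + slack K v      ≡⟨ cong (λ x → M + x * W v + slack K v) eq ⟨
    M + (W v + c v * W v) + slack K v   ≡⟨ cong (λ x → M + (W v + x) + slack K v) (cW≡M v) ⟩
    M + (W v + M) + slack K v           ≡⟨ eq₂ M (W v) (slack K v) ⟩
    2 * M + (slack K v + W v)           ∎)
    where
    open ≤-Reasoning
    eq₁ : ∀ M → 2 * M + 2 * M ≡ 2 * M * 2
    eq₁ = solve-∀
    eq₂ : ∀ M w t → M + (w + M) + t ≡ 2 * M + (t + w)
    eq₂ = solve-∀

  W≤M : ∀ v → W v ≤ M
  W≤M v = ≤-trans (m≤n*m (W v) (c v) {{>-nonZero (0<c v)}}) (≤-reflexive (cW≡M v))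

  module Exceptional {K : List (Fin n)} (mx : MaxClique V K) (z : Fin n) (L″ : List (Fin n))
                     (p : V ↭ K ++ z ∷ L″) (cz : suc (c z) ≡ length K) where

    private
      m = length L″
      ub′ : CliqueBound (z ∷ L″)
      ub′ = CliqueBound-⊆ (λ _ → ∈-allFin _) V-bound
      open ≤-Reasoning

    -- Two exceptional vertices would have slacks adding up to at least 4M - W(z) - W(v) ≥ 2M, the
    -- whole allowance.
    c-others : v ∈ L″ → c v ≡ length K
    c-others {v} v∈ = go (proj₂ (tight-vertex mx p (there v∈)))
      where
      eq : ∀ a b c d → a + b + (c + d) ≡ a + c + (b + d)
      eq = solve-∀
      go : c v ≡ length K ⊎ suc (c v) ≡ length K → c v ≡ length K
      go (inj₁ eq) = eq
      go (inj₂ cv) = ⊥-elim (<-irrefl {2 * M + 2 * M} refl (begin-strict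
        2 * M + 2 * M                                  ≤⟨ +-mono-≤ (low-slack mx V-bound (∈-allFin z) cz) (low-slack mx V-bound (∈-allFin v) cv) ⟩
        slack K z + W z + (slack K v + W v)            ≡⟨ eq (slack K z) (W z) (slack K v) (W v) ⟩
        slack K z + slack K v + (W z + W v)            ≤⟨ +-mono-≤ (+-monoʳ-≤ (slack K z) (∈⇒≤∑ (slack K) v∈)) (+-mono-≤ (W≤M z) (W≤M v)) ⟩
        ∑ (z ∷ L″) (slack K) + (M + M)                 <⟨ +-monoˡ-< (M + M) (slack-< mx V-bound p tight) ⟩
        2 * M + (M + M)                                ≡⟨ cong (λ x → 2 * M + (M + x)) (+-identityʳ M) ⟨
        2 * M + 2 * M                                  ∎))

    -- `z` alone uses 2M - W(z) of the allowance 2M, so the defect of what remains after removing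
    -- `K` stays below W(z).
    rest-tight : M * nonEdges (z ∷ L″) < suc m * ∑ (z ∷ L″) W + W z
    rest-tight = +-cancelˡ-< (2 * M) _ _ (begin-strict
      2 * M + E                            ≤⟨ +-monoˡ-≤ E (low-slack mx V-bound (∈-allFin z) cz) ⟩
      slack K z + W z + E                  ≤⟨ +-monoˡ-≤ E (+-monoˡ-≤ (W z) (m≤m+n (slack K z) (∑ L″ (slack K)))) ⟩
      ∑ (z ∷ L″) (slack K) + W z + E       ≡⟨ eq₁ (∑ (z ∷ L″) (slack K)) (W z) E ⟩
      ∑ (z ∷ L″) (slack K) + E + W z       <⟨ +-monoˡ-< (W z) (peel-< mx V-bound p tight) ⟩
      2 * M + suc m * ∑ (z ∷ L″) W + W z   ≡⟨ +-assoc (2 * M) _ (W z) ⟩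
      2 * M + (suc m * ∑ (z ∷ L″) W + W z) ∎)
      where
      E = M * nonEdges (z ∷ L″)
      eq₁ : ∀ a b c → a + b + c ≡ a + c + b
      eq₁ = solve-∀

    -- A longer `K′` would have c(z) + 1 elements, hence not contain `z`, and `z` would be
    -- exceptional for `K′` too. Its slack, at least 2M - W(z), would have to be below W(z), against
    -- W(z) ≤ M.
    rest-clique≤c : ∀ K′ → MaxClique (z ∷ L″) K′ → length K′ ≤ c z
    rest-clique≤c K′ mx′@((cl , sub) , _) = ≮⇒≥ λ lt →
      let eq : suc (c z) ≡ length K′
          eq = ≤-antisym lt (≤-trans (proj₂ mx K′ (cl , ⊆V K′)) (≤-reflexive (≡.sym cz)))
          L₃ , q = split cl sub
      in absurd lt eq L₃ q (∈-++⁻ K′ (∈-resp-↭ q (here refl)))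
      where
      absurd : c z < length K′ → suc (c z) ≡ length K′ → ∀ L₃ → z ∷ L″ ↭ K′ ++ L₃ → z ∈ K′ ⊎ z ∈ L₃ → ⊥
      absurd lt eq L₃ q (inj₁ z∈) = <⇒≱ lt (V-bound K′ (cl , ⊆V K′) z∈)
      absurd lt eq L₃ q (inj₂ z∈) = <-irrefl refl (begin-strict
        2 * M                        ≤⟨ low-slack mx′ ub′ (here refl) eq ⟩
        slack K′ z + W z             ≤⟨ +-monoˡ-≤ (W z) (∈⇒≤∑ (slack K′) z∈) ⟩
        ∑ L₃ (slack K′) + W z        <⟨ +-monoˡ-< (W z) (slack-< mx′ ub′ q rest-tight) ⟩
        W z + W z                    ≤⟨ +-mono-≤ (W≤M z) (W≤M z) ⟩
        M + M                        ≡⟨ cong (M +_) (+-identityʳ M) ⟨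
        2 * M                        ∎)

    rest-turán : ∀ K′ → MaxClique (z ∷ L″) K′ → suc m * suc m ≤ length K′ * nonEdges (z ∷ L″)
    rest-turán K′ (_ , max) = turán-bound G {L = z ∷ L″} (max (z ∷ []) ([] ∷ [] , here refl ∷ [])) max

    -- Suppose t < c(z), where t is the clique number of the N remaining vertices. None of their
    -- weights exceeds W(z), so Turán's bound and `rest-tight` give c(z) N² < t N² + t, hence N² < t
    -- ≤ N.
    c≤rest-clique : ∀ K′ → MaxClique (z ∷ L″) K′ → c z ≤ length K′
    c≤rest-clique K′ mx′@((cl , sub) , _) = ≮⇒≥ λ lt → <-irrefl refl (begin-strict
      N * N               <⟨ +-cancelˡ-< (t * (N * N)) _ _ (begin-strict
        t * (N * N) + N * N ≡⟨ +-comm (t * (N * N)) (N * N) ⟩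
        suc t * (N * N)     ≤⟨ *-monoˡ-≤ (N * N) lt ⟩
        c z * (N * N)       <⟨ *-cancelʳ-< (W z) _ _ (begin-strict
          c z * (N * N) * W z               ≡⟨ eq₁ (c z) (N * N) (W z) ⟩
          c z * W z * (N * N)               ≡⟨ cong (_* (N * N)) (cW≡M z) ⟩
          M * (N * N)                       ≤⟨ *-monoʳ-≤ M (rest-turán K′ mx′) ⟩
          M * (t * nonEdges (z ∷ L″))       ≡⟨ eq₂ M t _ ⟩
          t * (M * nonEdges (z ∷ L″))       <⟨ *-monoʳ-< t {{>-nonZero t>0}} rest-tight ⟩
          t * (N * ∑ (z ∷ L″) W + W z)      ≤⟨ *-monoʳ-≤ t (+-monoˡ-≤ (W z) (*-monoʳ-≤ N (begin
            ∑ (z ∷ L″) W            ≤⟨ ∑-mono-≤ (z ∷ L″) (λ {v} v∈ → W≤Wz v∈) ⟩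
            ∑ (z ∷ L″) (const (W z)) ≡⟨ ∑-const (z ∷ L″) (W z) ⟩
            N * W z                 ∎))) ⟩
          t * (N * (N * W z) + W z)         ≡⟨ eq₃ t N (W z) ⟩
          (t * (N * N) + t) * W z           ∎) ⟩
        t * (N * N) + t ∎) ⟩
      t                   ≤⟨ Unique-⊆⇒length≤ (IsClique⇒Unique cl) sub ⟩
      N                   ≤⟨ m≤m*n N N ⟩
      N * N               ∎)
      where
      N = suc m
      t = length K′
      t>0 : 0 < t
      t>0 = proj₂ mx′ (z ∷ []) ([] ∷ [] , here refl ∷ [])
      eq₁ : ∀ c n w → c * n * w ≡ c * w * n
      eq₁ = solve-∀
      eq₂ : ∀ M t e → M * (t * e) ≡ t * (M * e)
      eq₂ = solve-∀
      eq₃ : ∀ t N w → t * (N * (N * w) + w) ≡ (t * (N * N) + t) * w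
      eq₃ = solve-∀
      W≤Wz : v ∈ z ∷ L″ → W v ≤ W z
      W≤Wz (here refl)     = ≤-refl
      W≤Wz {v} (there v∈) = *-cancelˡ-≤ (c z) {{>-nonZero (0<c z)}} (begin
        c z * W v   ≤⟨ *-monoˡ-≤ (W v) (≤-trans (n≤1+n (c z)) (≤-reflexive (≡.trans cz (≡.sym (c-others v∈))))) ⟩
        c v * W v   ≡⟨ ≡.trans (cW≡M v) (≡.sym (cW≡M z)) ⟩
        c z * W z   ∎)

    -- By `rest-clique≤c`, Turán's bound gives N² ≤ c(z) ne for N = m + 1. The weights are now
    -- explicit, M / c(z) for `z` and M / (c(z) + 1) for the others; inserting them in `rest-tight`
    -- and cancelling leaves N m < c(z) + 1.
    few : ∀ K′ → MaxClique (z ∷ L″) K′ → suc m * m < suc (c z)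
    few K′ mx′ = +-cancelˡ-< (ω * N + c z * (N * m)) _ _ (≤-<-trans (≤-reflexive (eq₀ (c z) m))
      (*-cancelˡ-< M _ _ (begin-strict
        M * (ω * (N * N))                    ≤⟨ *-monoʳ-≤ M (*-monoʳ-≤ ω (rest-turán K′ mx′)) ⟩
        M * (ω * (length K′ * E))            ≤⟨ *-monoʳ-≤ M (*-monoʳ-≤ ω (*-monoˡ-≤ E (rest-clique≤c K′ mx′))) ⟩
        M * (ω * (c z * E))                  ≡⟨ eq₁ M ω (c z) E ⟩
        ω * c z * (M * E)                    <⟨ *-monoʳ-< (ω * c z) {{>-nonZero (*-mono-< {0} {ω} {0} (s≤s z≤n) (0<c z))}} rest-tight ⟩
        ω * c z * (N * (W z + ∑ L″ W) + W z) ≡⟨ eq₂ ω (c z) N (W z) (∑ L″ W) ⟩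
        ω * N * (c z * W z) + c z * N * (ω * ∑ L″ W) + ω * (c z * W z)
          ≡⟨ cong₂ (λ x y → ω * N * x + c z * N * y + ω * x) (cW≡M z) ω∑W ⟩
        ω * N * M + c z * N * (m * M) + ω * M ≡⟨ eq₃ ω N M (c z) m ⟩
        M * (ω * N + c z * (N * m) + ω)      ∎)))
      where
      N = suc m
      ω = suc (c z)
      E = nonEdges (z ∷ L″)
      ω∑W : ω * ∑ L″ W ≡ m * M
      ω∑W = ≡.trans (≡.sym (*-distribˡ-∑ L″ ω W)) (≡.trans
        (∑-cong L″ λ {v} v∈ → ≡.trans (cong (_* W v) (≡.trans cz (≡.sym (c-others v∈)))) (cW≡M v)) (∑-const L″ M))
      eq₀ : ∀ c m → suc c * suc m + c * (suc m * m) + suc m * m ≡ suc c * (suc m * suc m)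
      eq₀ = solve-∀
      eq₁ : ∀ M ω c e → M * (ω * (c * e)) ≡ ω * c * (M * e)
      eq₁ = solve-∀
      eq₂ : ∀ ω c N w S → ω * c * (N * (w + S) + w) ≡ ω * N * (c * w) + c * N * (ω * S) + ω * (c * w)
      eq₂ = solve-∀
      eq₃ : ∀ ω N M c m → ω * N * M + c * N * (m * M) + ω * M ≡ M * (ω * N + c * (N * m) + ω)
      eq₃ = solve-∀

    nonNbrs-z : nonNbrs K z ≡ 2
    nonNbrs-z = +-cancelˡ-≡ (c z) _ _ (≡.trans (proj₁ (tight-vertex mx p (here refl)))
      (≡.trans (cong suc (≡.sym cz)) (+-comm 2 (c z))))

  -- In `Y` the vertex 1 is isolated, hence `z` is listed between the ends of the edge.
  ≅-Y : ∀ k₁ k₂ z → V ↭ k₁ ∷ k₂ ∷ z ∷ [] → adj G k₁ k₂ ≡ true → nonNbrs (k₁ ∷ k₂ ∷ []) z ≡ 2 → G ≅ Y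
  ≅-Y k₁ k₂ z p k₁k₂ nz with adj G z k₁ in zk₁ | adj G z k₂ in zk₂
  ... | false | false = ≅-lookup G (k₁ ∷ z ∷ k₂ ∷ []) (↭-trans p (prep k₁ (swap k₂ z ↭-refl))) Y
    ((≡.trans (Graph.sym G k₁ z) zk₁ ∷ k₁k₂ ∷ []) ∷ (zk₂ ∷ []) ∷ [] ∷ [])

  ... | true  | true  = contradiction nz λ ()
  ... | true  | false = contradiction nz λ ()
  ... | false | true  = contradiction nz λ ()

  -- `y` misses `k₁`, as otherwise `z`, `y`, `k₁` would form a triangle through `z`; so `y` is
  -- adjacent to `k₂` and `k₃`. The non-edges are the pair `y`, `k₁` and the path `k₂`, `z`, `k₃`,
  -- which fixes the order of the list.
  ≅-X : ∀ z y k₁ k₂ k₃ → V ↭ y ∷ k₁ ∷ k₂ ∷ z ∷ k₃ ∷ [] → IsClique G (k₁ ∷ k₂ ∷ k₃ ∷ []) → c z ≡ 2 →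
           adj G z y ≡ true → adj G z k₁ ≡ true → adj G z k₂ ≡ false → adj G z k₃ ≡ false →
           nonNbrs (k₁ ∷ k₂ ∷ k₃ ∷ []) y ≡ 1 → G ≅ X
  ≅-X z y k₁ k₂ k₃ p ((k₁k₂ ∷ k₁k₃ ∷ []) ∷ (k₂k₃ ∷ []) ∷ _) cz zy zk₁ zk₂ zk₃ ny with adj G y k₁ in yk₁
  ... | true  = contradiction
    (subst (3 ≤_) cz (proj₂ (cliqueNumber z) (z ∷ y ∷ k₁ ∷ []) ((zy ∷ zk₁ ∷ []) ∷ (yk₁ ∷ []) ∷ [] ∷ []) (here refl)))
    (λ { (s≤s (s≤s ())) })
  ... | false with yk₂ ∷ yk₃ ∷ [] ← nonNbrs≡0⁻ (k₂ ∷ k₃ ∷ []) (suc-injective ny) =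
    ≅-lookup G (y ∷ k₁ ∷ k₂ ∷ z ∷ k₃ ∷ []) p X
      ( (yk₁ ∷ yk₂ ∷ adj-sym zy ∷ yk₃ ∷ [])
      ∷ (k₁k₂ ∷ adj-sym zk₁ ∷ k₁k₃ ∷ [])
      ∷ (≡.trans (Graph.sym G k₂ z) zk₂ ∷ k₂k₃ ∷ [])
      ∷ (zk₃ ∷ []) ∷ [] ∷ [])

  exceptional⇒X⊎Y : ∀ K z L″ → MaxClique V K → V ↭ K ++ z ∷ L″ → suc (c z) ≡ length K → G ≅ X ⊎ G ≅ Y
  exceptional⇒X⊎Y K z L″ mx p cz = go L″ p (maxClique (z ∷ L″))
    where
    adjacent : ∀ {y} K′ → 2 ≤ length K′ → Clique (z ∷ y ∷ []) K′ → adj G z y ≡ true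
    adjacent (a ∷ [])    (s≤s ())
    adjacent (a ∷ b ∷ _) _ ((ab ∷ _) ∷ _ , here refl ∷ here refl ∷ _)                 = contradiction refl (adj⇒≢ ab)
    adjacent (a ∷ b ∷ _) _ ((ab ∷ _) ∷ _ , here refl ∷ there (here refl) ∷ _)         = ab
    adjacent (a ∷ b ∷ _) _ ((ab ∷ _) ∷ _ , there (here refl) ∷ here refl ∷ _)         = adj-sym ab
    adjacent (a ∷ b ∷ _) _ ((ab ∷ _) ∷ _ , there (here refl) ∷ there (here refl) ∷ _) = contradiction refl (adj⇒≢ ab)

    triangle : ∀ K y → length K ≡ 3 → IsClique G K → V ↭ K ++ z ∷ y ∷ [] → c z ≡ 2 →
               adj G z y ≡ true → nonNbrs K z ≡ 2 → nonNbrs K y ≡ 1 → G ≅ X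
    triangle K@(a ∷ b ∷ d ∷ []) y refl cl p cz zy nz ny = cases (adj G z a) (adj G z b) (adj G z d) refl refl refl nz
      where
      reorder : ∀ k₁ k₂ k₃ → K ↭ k₁ ∷ k₂ ∷ k₃ ∷ [] →
                adj G z k₁ ≡ true → adj G z k₂ ≡ false → adj G z k₃ ≡ false → G ≅ X
      reorder k₁ k₂ k₃ q zk₁ zk₂ zk₃ = ≅-X z y k₁ k₂ k₃
        (↭-trans p (↭-trans (++⁺ʳ (z ∷ y ∷ []) q) (↭-trans (shift y (k₁ ∷ k₂ ∷ k₃ ∷ z ∷ []) [])
          (prep y (prep k₁ (prep k₂ (swap k₃ z ↭-refl)))))))
        (AllPairs-resp-↭ adj-sym q cl) cz zy zk₁ zk₂ zk₃ (≡.trans (≡.sym (∑-↭ (nonadj y) q)) ny)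
      cases : ∀ b₁ b₂ b₃ → adj G z a ≡ b₁ → adj G z b ≡ b₂ → adj G z d ≡ b₃ →
              (if adj G z a then 0 else 1) + ((if adj G z b then 0 else 1) + ((if adj G z d then 0 else 1) + 0)) ≡ 2 → G ≅ X
      cases true  false false e₁ e₂ e₃ _ = reorder a b d ↭-refl e₁ e₂ e₃
      cases false true  false e₁ e₂ e₃ _ = reorder b a d (swap a b ↭-refl) e₂ e₁ e₃
      cases false false true  e₁ e₂ e₃ _ = reorder d a b (shift d (a ∷ b ∷ []) []) e₃ e₁ e₂
      cases true  true  true  e₁ e₂ e₃ eq rewrite e₁ | e₂ | e₃ = contradiction eq λ ()
      cases true  true  false e₁ e₂ e₃ eq rewrite e₁ | e₂ | e₃ = contradiction eq λ ()
      cases true  false true  e₁ e₂ e₃ eq rewrite e₁ | e₂ | e₃ = contradiction eq λ ()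
      cases false true  true  e₁ e₂ e₃ eq rewrite e₁ | e₂ | e₃ = contradiction eq λ ()
      cases false false false e₁ e₂ e₃ eq rewrite e₁ | e₂ | e₃ = contradiction eq λ ()

    edge : ∀ K → length K ≡ 2 → IsClique G K → V ↭ K ++ z ∷ [] → nonNbrs K z ≡ 2 → G ≅ Y
    edge (k₁ ∷ k₂ ∷ []) refl ((k₁k₂ ∷ []) ∷ _) p nz = ≅-Y k₁ k₂ z p k₁k₂ nz

    go : ∀ L″ → V ↭ K ++ z ∷ L″ → ∃ (MaxClique (z ∷ L″)) → G ≅ X ⊎ G ≅ Y
    go L″ p (K′ , mx′@((cl′ , sub′) , _)) = byLength L″ p mx′ nonNbrs-z
      (≤-trans (c≤rest-clique K′ mx′) (Unique-⊆⇒length≤ (IsClique⇒Unique cl′) sub′)) (few K′ mx′)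
      where
      open Exceptional mx z L″ p cz
      -- For m = |L″| the two inequalities read m (m + 1) ≤ c(z) ≤ m + 1, so m is at most 1: m = 0
      -- gives c(z) = 1 and an edge `K`, m = 1 gives c(z) = 2 and a triangle `K`.
      byLength : ∀ L″ → V ↭ K ++ z ∷ L″ → MaxClique (z ∷ L″) K′ → nonNbrs K z ≡ 2 → c z ≤ suc (length L″) →
                 suc (length L″) * length L″ < suc (c z) → G ≅ X ⊎ G ≅ Y
      byLength [] p _ nz le _ = inj₂
        (edge K (≡.trans (≡.sym cz) (cong suc (≤-antisym le (0<c z)))) (proj₁ (proj₁ mx)) p nz)
      byLength (y ∷ []) p mx″ nz le lt = inj₁
        (triangle K y (≡.trans (≡.sym cz) (cong suc cz≡2)) (proj₁ (proj₁ mx)) p cz≡2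
          (adjacent K′ (≤-trans (≤-reflexive (≡.sym cz≡2)) (Exceptional.c≤rest-clique mx z (y ∷ []) p cz K′ mx″)) (proj₁ mx″)) nz
          (+-cancelˡ-≡ (length K) _ _ (≡.trans
            (cong (_+ nonNbrs K y) (≡.sym (Exceptional.c-others mx z (y ∷ []) p cz (here refl))))
            (≡.trans (proj₁ (tight-vertex mx p (there (here refl)))) (+-comm 1 (length K))))))
        where
        cz≡2 : c z ≡ 2
        cz≡2 = ≤-antisym le (≤-pred lt)
      byLength (_ ∷ _ ∷ L₃) p _ _ le lt = contradiction (≤-trans lt (s≤s le)) (<⇒≱ (begin
        suc (4 + l)                       ≤⟨ m≤m+n _ (2 + 4 * l + l * l) ⟩
        suc (4 + l) + (2 + 4 * l + l * l)   ≡⟨ eq l ⟩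
        suc ((3 + l) * (2 + l))           ∎))
        where
        open ≤-Reasoning
        l = length L₃
        eq : ∀ l → suc (4 + l) + (2 + 4 * l + l * l) ≡ suc ((3 + l) * (2 + l))
        eq = solve-∀

  tight⇒extremal : 0 < n → InS G ⊎ (G ≅ X ⊎ G ≅ Y)
  tight⇒extremal n>0 = go (maxClique V)
    where
    go : ∃ (MaxClique V) → InS G ⊎ (G ≅ X ⊎ G ≅ Y)
    go (K , mx@((cl , sub) , max)) = onRest (split cl sub)
      where
      onRest : (∃ λ L′ → V ↭ K ++ L′) → InS G ⊎ (G ≅ X ⊎ G ≅ Y)
      onRest (L′ , p) with All.all? (λ v → c v ≟ length K) L′
      ... | yes all = inj₁ (Regular.regular⇒InS (length K)
          (max (fromℕ< n>0 ∷ []) ([] ∷ [] , ∈-allFin _ ∷ [])) (λ v → onV v (∈-++⁻ K (∈-resp-↭ p (∈-allFin v)))) K cl refl)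
        where
        onV : ∀ v → v ∈ K ⊎ v ∈ L′ → c v ≡ length K
        onV v (inj₁ v∈) = ≤-antisym (c≤length mx v) (V-bound K (cl , sub) v∈)
        onV v (inj₂ v∈) = All.lookup all v∈
      ... | no ¬all = inj₂ (fromAny (find (AllP.¬All⇒Any¬ (λ v → c v ≟ length K) L′ ¬all)))
        where
        fromAny : (∃ λ z → z ∈ L′ × c z ≢ length K) → G ≅ X ⊎ G ≅ Y
        fromAny (z , z∈ , ≢) with L″ , q ← ∈⇒↭ z∈ =
          exceptional⇒X⊎Y K z L″ mx (↭-trans p (++⁺ˡ K q)) (low (proj₂ (tight-vertex mx p z∈)))
          where
          low : c z ≡ length K ⊎ suc (c z) ≡ length K → suc (c z) ≡ length K
          low (inj₁ eq) = contradiction eq ≢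
          low (inj₂ eq) = eq

-- The converse: the listed graphs attain the bound.

IsTight : ∀ {n} → Graph n → Set
IsTight {n} G = ∀ M → 0 < M → (c W : Fin n → ℕ) → (∀ v → c v * W v ≡ M) →
  (∀ v → Σ (List (Fin n)) λ K → IsClique G K × v ∈ K × length K ≡ c v) →
  M * Peeling.nonEdges G (allFin n) < length (allFin n) * ∑ (allFin n) W + 2 * M

IsTight-≅ : ∀ {m n} (G : Graph n) (H : Graph m) → G ≅ H → IsTight H → IsTight G
IsTight-≅ {m} {n} G H iso@(f , h) tightH M M>0 c W cW≡M attained = subst₂ _<_
  (cong (M *_) (≡.sym (nonEdges-≅ G H iso)))
  (cong (_+ 2 * M) (cong₂ _*_ same-length same-∑))
  (tightH M M>0 (c ∘ from) (W ∘ from) (cW≡M ∘ from) attained′)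
  where
  open Inverse f using (to; from; strictlyInverseˡ; strictlyInverseʳ)
  same-length : length (allFin m) ≡ length (allFin n)
  same-length = ≡.trans (≡.sym (*-identityʳ _)) (≡.trans (≡.sym (∑-const (allFin m) 1))
    (≡.trans (≡.sym (∑-↔ f (const 1))) (≡.trans (∑-const (allFin n) 1) (*-identityʳ _))))
  same-∑ : ∑ (allFin m) (W ∘ from) ≡ ∑ (allFin n) W
  same-∑ = ≡.trans (≡.sym (∑-↔ f (W ∘ from))) (∑-cong (allFin n) λ {v} _ → cong W (strictlyInverseʳ v))
  attained′ : ∀ i → Σ (List (Fin m)) λ K → IsClique H K × i ∈ K × length K ≡ c (from i)
  attained′ i with K , cl , i∈ , len ← attained (from i) =
      map to K
    , AllPairsP.map⁺ (AllPairs.map (λ {u} {v} uv → ≡.trans (h u v) uv) cl)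
    , subst (_∈ map to K) (strictlyInverseˡ i) (∈-map⁺ to i∈)
    , ≡.trans (length-map to K) len

-- Values of `c` attained by cliques satisfy c ≤ b, hence W / M ≥ g / D, and larger weights only
-- help the strict inequality. One check with the upper bounds `b` thus settles every admissible
-- `M`, `c`, `W`.
IsTight-bounds : ∀ {n} (G : Graph n) D → (b g : Fin n → ℕ) → (∀ v → b v * g v ≡ D) →
  (∀ v K → IsClique G K → v ∈ K → length K ≤ b v) →
  D * Peeling.nonEdges G (allFin n) < length (allFin n) * ∑ (allFin n) g + 2 * D → IsTight G
IsTight-bounds {n} G D b g bg≡D bounded lt M M>0 c W cW≡M attained = *-cancelˡ-< D _ _ (begin-strict
  D * (M * E)                    ≡⟨ eq₁ D M E ⟩
  M * (D * E)                    <⟨ *-monoʳ-< M {{>-nonZero M>0}} lt ⟩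
  M * (N * ∑ V g + 2 * D)        ≡⟨ eq₂ M N (∑ V g) D ⟩
  N * (M * ∑ V g) + 2 * D * M    ≤⟨ +-monoˡ-≤ (2 * D * M) (*-monoʳ-≤ N sums) ⟩
  N * (D * ∑ V W) + 2 * D * M    ≡⟨ eq₃ N D (∑ V W) M ⟩
  D * (N * ∑ V W + 2 * M)        ∎)
  where
  open ≤-Reasoning
  V = allFin n
  N = length V
  E = Peeling.nonEdges G V
  eq₁ : ∀ D M E → D * (M * E) ≡ M * (D * E)
  eq₁ = solve-∀
  eq₂ : ∀ M N g D → M * (N * g + 2 * D) ≡ N * (M * g) + 2 * D * M
  eq₂ = solve-∀
  eq₃ : ∀ N D W M → N * (D * W) + 2 * D * M ≡ D * (N * W + 2 * M)
  eq₃ = solve-∀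
  eq₄ : ∀ b w g → b * w * g ≡ b * g * w
  eq₄ = solve-∀
  c≤b : ∀ v → c v ≤ b v
  c≤b v with K , cl , v∈ , len ← attained v = subst (_≤ b v) len (bounded v K cl v∈)
  sums : M * ∑ V g ≤ D * ∑ V W
  sums = begin
    M * ∑ V g              ≡⟨ *-distribˡ-∑ V M g ⟨
    ∑ V (λ v → M * g v)    ≤⟨ ∑-mono-≤ V (λ {v} _ → begin
      M * g v              ≡⟨ cong (_* g v) (cW≡M v) ⟨
      c v * W v * g v      ≤⟨ *-monoˡ-≤ (g v) (*-monoˡ-≤ (W v) (c≤b v)) ⟩
      b v * W v * g v      ≡⟨ eq₄ (b v) (W v) (g v) ⟩
      b v * g v * W v      ≡⟨ cong (_* W v) (bg≡D v) ⟩
      D * W v              ∎) ⟩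
    ∑ V (λ v → D * W v)    ≡⟨ *-distribˡ-∑ V D W ⟩
    D * ∑ V W              ∎

-- A proper colouring is injective on a clique.
colouring-bound : ∀ {n r} (G : Graph n) (colour : Fin n → Fin r) →
  (∀ u v → colour u ≡ colour v → adj G u v ≡ false) → ∀ K → IsClique G K → length K ≤ r
colouring-bound {r = r} G colour proper K cl = begin
  length K               ≡⟨ length-map colour K ⟨
  length (map colour K)  ≤⟨ Unique-⊆⇒length≤ (AllPairsP.map⁺ (AllPairs.map distinct cl)) (All.tabulate λ _ → ∈-allFin _) ⟩
  length (allFin r)      ≡⟨ length-allFin r ⟩
  r                      ∎
  where
  open ≤-Reasoning
  distinct : ∀ {u v} → adj G u v ≡ true → colour u ≢ colour v
  distinct {u} {v} uv eq with () ← ≡.trans (≡.sym uv) (proper u v eq)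

proper? : ∀ {n r} (G : Graph n) (colour : Fin n → Fin r) → Dec (∀ u v → colour u ≡ colour v → adj G u v ≡ false)
proper? G colour = Fin.all? λ u → Fin.all? λ v → (colour u Fin.≟ colour v) →-dec (adj G u v ≟ᵇ false)

independent-nbhd-bound : ∀ {n} (G : Graph n) z → (∀ a b → adj G z a ≡ true → adj G z b ≡ true → adj G a b ≡ false) →
  ∀ K → IsClique G K → z ∈ K → length K ≤ 2
independent-nbhd-bound G z free K cl z∈ with K₀ , p ← ∈⇒↭ z∈ with AllPairs-resp-↭ (Peeling.adj-sym G) p cl
... | zK₀ ∷ cl₀ = ≤-trans (≤-reflexive (↭-length p)) (s≤s (small K₀ zK₀ cl₀))
  where
  small : ∀ K₀ → All (λ a → adj G z a ≡ true) K₀ → IsClique G K₀ → length K₀ ≤ 1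
  small []          _             _               = z≤n
  small (a ∷ [])    _             _               = s≤s z≤n
  small (a ∷ b ∷ _) (za ∷ zb ∷ _) ((ab ∷ _) ∷ _) with () ← ≡.trans (≡.sym ab) (free a b za zb)

-- Vertex 3, the middle of the removed path, has only the neighbours 0 and 1, which are not
-- adjacent. For D = 6 the two sides are 66 = 6 · 11 and 67 = 5 · 11 + 12.
X-tight : IsTight X
X-tight = IsTight-bounds X 6 b g bg bounded (from-yes (66 <? 67))
  where
  b g : Fin 5 → ℕ
  b = λ where 3F → 2
              _  → 3
  g = λ where 3F → 3
              _  → 2
  bg : ∀ v → b v * g v ≡ 6
  bg = from-yes (Fin.all? λ v → b v * g v ≟ 6)
  colour : Fin 5 → Fin 3
  colour = λ where 0F → 0F
                   1F → 0F
                   4F → 2F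
                   _  → 1F
  coloured : ∀ K → IsClique X K → length K ≤ 3
  coloured = colouring-bound X colour (from-yes (proper? X colour))
  bounded : ∀ v K → IsClique X K → v ∈ K → length K ≤ b v
  bounded 0F K cl _  = coloured K cl
  bounded 1F K cl _  = coloured K cl
  bounded 2F K cl _  = coloured K cl
  bounded 3F K cl v∈ = independent-nbhd-bound X 3F (from-yes (Fin.all? λ u → Fin.all? λ v →
    (adj X 3F u ≟ᵇ true) →-dec ((adj X 3F v ≟ᵇ true) →-dec (adj X u v ≟ᵇ false)))) K cl v∈
  bounded 4F K cl _  = coloured K cl

Y-tight : IsTight Y
Y-tight = IsTight-bounds Y 2 b g bg bounded (from-yes (14 <? 16))
  where
  b g : Fin 3 → ℕ
  b = λ where 1F → 1
              _  → 2
  g = λ where 1F → 2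
              _  → 1
  bg : ∀ v → b v * g v ≡ 2
  bg = from-yes (Fin.all? λ v → b v * g v ≟ 2)
  colour : Fin 3 → Fin 2
  colour = λ where 2F → 1F
                   _  → 0F
  coloured : ∀ K → IsClique Y K → length K ≤ 2
  coloured = colouring-bound Y colour (from-yes (proper? Y colour))
  isolated : ∀ v → adj Y 1F v ≡ false
  isolated = from-yes (Fin.all? λ v → adj Y 1F v ≟ᵇ false)
  alone : ∀ K₀ → IsClique Y (1F ∷ K₀) → length (1F ∷ K₀) ≤ 1
  alone []      _              = s≤s z≤n
  alone (x ∷ _) ((zx ∷ _) ∷ _) with () ← ≡.trans (≡.sym zx) (isolated x)
  bounded : ∀ v K → IsClique Y K → v ∈ K → length K ≤ b v
  bounded 0F K cl _  = coloured K cl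
  bounded 1F K cl v∈ with K₀ , p ← ∈⇒↭ v∈ =
    ≤-trans (≤-reflexive (↭-length p)) (alone K₀ (AllPairs-resp-↭ (λ {u} {v} → Peeling.adj-sym Y {u} {v}) p cl))
  bounded 2F K cl _  = coloured K cl

-- The residues colour the graph with r colours. The bound r also serves for n < r, where no clique
-- reaches it, because `IsTight-bounds` works with upper bounds.
turán-tight : ∀ n k → (n % suc k ≤ 2) ⊎ (suc k * (n % suc k ∸ 2) < (n % suc k) * (n % suc k)) → IsTight (turán n k)
turán-tight n k cond = IsTight-bounds (turán n k) r (const r) (const 1) (λ _ → *-identityʳ r)
  (λ _ K cl _ → colouring-bound (turán n k) colour proper K cl)
  (+-cancelʳ-< (s * s) _ _ (begin-strict
    r * E + s * s              ≡⟨ nonEdges-turán n ⟩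
    n * n + s * r              <⟨ +-monoʳ-< (n * n) (⇒deficiency-< {s} cond) ⟩
    n * n + (s * s + 2 * r)    ≡⟨ eq (n * n) (s * s) (2 * r) ⟩
    n * n + 2 * r + s * s      ≡⟨ cong (λ x → x + 2 * r + s * s) (cong₂ _*_ (length-allFin n)
                                    (≡.trans (∑-const V 1) (≡.trans (*-identityʳ _) (length-allFin n)))) ⟨
    length V * ∑ V (const 1) + 2 * r + s * s ∎))
  where
  open ≤-Reasoning
  open Residues k
  r = suc k
  s = n % r
  V = allFin n
  E = Peeling.nonEdges (turán n k) V
  eq : ∀ a b c → a + (b + c) ≡ a + c + b
  eq = solve-∀
  colour : Fin n → Fin r
  colour v = fromℕ< (m%n<n (toℕ v) r)
  proper : ∀ u v → colour u ≡ colour v → adj (turán n k) u v ≡ false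
  proper u v eq = turán-same n u v (≡.trans (≡.sym (Fin.toℕ-fromℕ< _)) (≡.trans (cong toℕ eq) (Fin.toℕ-fromℕ< _)))

extremal⇒tight : ∀ {n} (G : Graph n) → InS G ⊎ (G ≅ X ⊎ G ≅ Y) → IsTight G
extremal⇒tight G (inj₁ (k , cond , iso)) = IsTight-≅ G (turán _ k) iso (turán-tight _ k cond)
extremal⇒tight G (inj₂ (inj₁ iso))       = IsTight-≅ G X iso X-tight
extremal⇒tight G (inj₂ (inj₂ iso))       = IsTight-≅ G Y iso Y-tight

-- Opened only here because the prefix operator +_ would make the sections (m +_) ambiguous.
open import Data.Integer as ℤ using (+_) renaming (_≤_ to _≤ℤ_)
open import Data.Integer.DivMod using ([n/d]*d≤n; div-pos-is-/ℕ; n<s[n/ℕd]*d)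
import Data.Integer.Properties as ℤ
open import Data.Integer.Tactic.RingSolver using () renaming (solve-∀ to ℤ-solve-∀)
open import Data.Rational as ℚ using (mkℚ; floor; toℚᵘ)
open import Data.Rational.Properties using (toℚᵘ-fromℚᵘ; toℚᵘ-homo-+; toℚᵘ-homo-*)
open import Data.Rational.Unnormalised using (mkℚᵘ; *≡*) renaming (_≃_ to _≃ᵘ_)
open import Data.Rational.Unnormalised.Properties as ℚᵘ using (≃-trans)

-- The floor of the rational bound in integer terms.

i<suc[j]⇒i≤j : ∀ {i j} → i ℤ.< ℤ.suc j → i ≤ℤ j
i<suc[j]⇒i≤j {i} {j} lt = subst (i ≤ℤ_) (ℤ.pred-suc j) (ℤ.i<j⇒i≤pred[j] lt)

-- `q` is stored in lowest terms, so the estimates of integer division are moved to the denominator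
-- k + 1 by cross-multiplication.
floor-bounds : ∀ q P k → toℚᵘ q ≃ᵘ mkℚᵘ (+ P) k →
               floor q ℤ.* + suc k ℤ.≤ + P × + P ℤ.< ℤ.suc (floor q) ℤ.* + suc k
floor-bounds (mkℚ a d _) P k (*≡* eq) =
    ℤ.*-cancelʳ-≤-pos _ _ D (begin
      f ℤ.* Q ℤ.* D           ≡⟨ swap-right f Q D ⟩
      f ℤ.* D ℤ.* Q           ≤⟨ ℤ.*-monoʳ-≤-nonNeg Q ([n/d]*d≤n a D) ⟩
      a ℤ.* Q                 ≡⟨ eq ⟩
      + P ℤ.* D               ∎)
  , ℤ.*-cancelʳ-<-nonNeg D (begin-strict
      + P ℤ.* D               ≡⟨ eq ⟨
      a ℤ.* Q                 <⟨ ℤ.*-monoʳ-<-pos Q (subst (λ x → a ℤ.< ℤ.suc x ℤ.* D) (≡.sym (div-pos-is-/ℕ a (suc d))) (n<s[n/ℕd]*d a (suc d))) ⟩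
      ℤ.suc f ℤ.* D ℤ.* Q     ≡⟨ swap-right (ℤ.suc f) D Q ⟩
      ℤ.suc f ℤ.* Q ℤ.* D     ∎)
  where
  open ℤ.≤-Reasoning
  Q = + suc k
  D = + suc d
  f = a ℤ./ D
  swap-right : ∀ x y z → x ℤ.* y ℤ.* z ≡ x ℤ.* z ℤ.* y
  swap-right = ℤ-solve-∀

-- For c w = M = k + 1, (c - 1) / c = 1 - 1 / c = (M - w) / M. Unnormalised fractions store the
-- predecessor of the denominator.
toℚᵘ-frac : ∀ c w k → c * w ≡ suc k → toℚᵘ (frac c) ≃ᵘ mkℚᵘ (+ (suc k ∸ w)) k
toℚᵘ-frac (suc j) w k eq = ≃-trans (toℚᵘ-fromℚᵘ (mkℚᵘ (+ j) j)) (*≡* (begin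
  + j ℤ.* + suc k            ≡⟨ ℤ.pos-* j (suc k) ⟨
  + (j * suc k)              ≡⟨ cong +_ nat ⟩
  + ((suc k ∸ w) * suc j)    ≡⟨ ℤ.pos-* (suc k ∸ w) (suc j) ⟩
  + (suc k ∸ w) ℤ.* + suc j  ∎))
  where
  open ≡-Reasoning
  assoc : ∀ j w → j * (suc j * w) ≡ j * w * suc j
  assoc = solve-∀
  nat : j * suc k ≡ (suc k ∸ w) * suc j
  nat = ≡.trans (cong (j *_) (≡.sym eq)) (≡.trans (assoc j w)
    (cong (_* suc j) (≡.sym (≡.trans (cong (_∸ w) (≡.sym eq)) (m+n∸m≡n w (j * w))))))

toℚᵘ-sum-frac : ∀ {n} (c W : Fin n → ℕ) k → (∀ v → c v * W v ≡ suc k) → ∀ L →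
  toℚᵘ (sumℚ (map (λ v → frac (c v)) L)) ≃ᵘ mkℚᵘ (+ ∑ L (λ v → suc k ∸ W v)) k
toℚᵘ-sum-frac c W k cW []      = *≡* refl
toℚᵘ-sum-frac c W k cW (v ∷ L) = ≃-trans (toℚᵘ-homo-+ (frac (c v)) _)
  (≃-trans (ℚᵘ.+-cong (toℚᵘ-frac (c v) (W v) k (cW v)) (toℚᵘ-sum-frac c W k cW L)) (*≡* (begin
    (+ a ℤ.* D ℤ.+ + b ℤ.* D) ℤ.* D         ≡⟨ eq (+ a) (+ b) D ⟩
    (+ a ℤ.+ + b) ℤ.* (D ℤ.* D)             ≡⟨ cong₂ ℤ._*_ (ℤ.pos-+ a b) (ℤ.pos-* (suc k) (suc k)) ⟨
    + (a + b) ℤ.* + (suc k * suc k)         ∎)))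
  where
  open ≡-Reasoning
  a = suc k ∸ W v
  b = ∑ L (λ v → suc k ∸ W v)
  D = + suc k
  eq : ∀ a b d → (a ℤ.* d ℤ.+ b ℤ.* d) ℤ.* d ≡ (a ℤ.+ b) ℤ.* (d ℤ.* d)
  eq = ℤ-solve-∀

bound-bounds : ∀ {n} (c W : Fin n → ℕ) k → (∀ v → c v * W v ≡ suc k) → let P = n * ∑ (allFin n) (λ v → suc k ∸ W v) in
  bound n c ℤ.* + (2 * suc k) ℤ.≤ + P × + P ℤ.< ℤ.suc (bound n c) ℤ.* + (2 * suc k)
-- The argument `k + 1 * suc k` is the predecessor of the denominator 2 (k + 1).
bound-bounds {n} c W k cW = floor-bounds _ P (k + 1 * suc k)
  (≃-trans (toℚᵘ-homo-* (+ n ℚ./ 2) _)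
    (≃-trans (ℚᵘ.*-cong (toℚᵘ-fromℚᵘ (mkℚᵘ (+ n) 1)) (toℚᵘ-sum-frac c W k cW (allFin n)))
      (*≡* (cong (ℤ._* + (2 * suc k)) (≡.sym (ℤ.pos-* n S))))))
  where
  S = ∑ (allFin n) (λ v → suc k ∸ W v)
  P = n * S

-- Edges, non-adjacent pairs, and the comparison with the floor.

module _ {n : ℕ} (G : Graph n) where
  open Peeling G

  private
    V = allFin n
    up : Fin n → Fin n → ℕ
    up u v = if (toℕ u <ᵇ toℕ v) ∧ adj G u v then 1 else 0
    up-yes : ∀ {u v} → toℕ u < toℕ v → up u v ≡ (if adj G u v then 1 else 0)
    up-yes {u} {v} lt with toℕ u <ᵇ toℕ v in eq
    ... | true  = refl
    ... | false = contradiction (<⇒<ᵇ lt) (subst T eq)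
    up-no : ∀ {u v} → ¬ (toℕ u < toℕ v) → up u v ≡ 0
    up-no {u} {v} ≮ with toℕ u <ᵇ toℕ v in eq
    ... | false = refl
    ... | true  = contradiction (<ᵇ⇒< (toℕ u) (toℕ v) (subst T (≡.sym eq) _)) ≮
    complement : ∀ b → (if b then 1 else 0) + (if b then 0 else 1) ≡ 1
    complement true  = refl
    complement false = refl

    -- An ordered pair is adjacent and increasing, adjacent and decreasing, or non-adjacent, the
    -- last including u = v.
    pair : ∀ u v → up u v + up v u + nonadj u v ≡ 1
    pair u v with <-cmp (toℕ u) (toℕ v)
    ... | tri< u<v _ v≮u = ≡.trans (cong₂ (λ x y → x + y + nonadj u v) (up-yes u<v) (up-no {v} {u} v≮u))
      (≡.trans (cong (_+ nonadj u v) (+-identityʳ _)) (complement (adj G u v)))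
    ... | tri≈ u≮v u≡v v≮u = ≡.trans (cong₂ (λ x y → x + y + nonadj u v) (up-no {u} {v} u≮v) (up-no {v} {u} v≮u))
      (≡.trans (cong (nonadj u) (≡.sym (Fin.toℕ-injective u≡v))) (nonadj-refl u))
    ... | tri> u≮v _ v<u = ≡.trans (cong₂ (λ x y → x + y + nonadj u v) (up-no {u} {v} u≮v) (up-yes v<u))
      (≡.trans (cong (λ x → (if adj G v u then 1 else 0) + x) (nonadj-sym u v)) (complement (adj G v u)))

  2*edgeCount+nonEdges : 2 * edgeCount G + nonEdges V ≡ length V * length V
  2*edgeCount+nonEdges = begin
    2 * edgeCount G + nonEdges V
      ≡⟨ cong (λ x → edgeCount G + x + nonEdges V) (≡.trans (+-identityʳ _) (∑-comm V V up)) ⟩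
    ∑ V (λ u → ∑ V (up u)) + ∑ V (λ u → ∑ V (λ v → up v u)) + nonEdges V
      ≡⟨ cong (_+ nonEdges V) (∑-distrib-+ V _ _) ⟨
    ∑ V (λ u → ∑ V (up u) + ∑ V (λ v → up v u)) + nonEdges V
      ≡⟨ ∑-distrib-+ V _ _ ⟨
    ∑ V (λ u → ∑ V (up u) + ∑ V (λ v → up v u) + nonNbrs V u)
      ≡⟨ ∑-cong V (λ {u} _ → row u) ⟩
    ∑ V (const (length V))
      ≡⟨ ∑-const V (length V) ⟩
    length V * length V ∎
    where
    open ≡-Reasoning
    row : ∀ u → ∑ V (up u) + ∑ V (λ v → up v u) + nonNbrs V u ≡ length V
    row u = begin
      ∑ V (up u) + ∑ V (λ v → up v u) + nonNbrs V u     ≡⟨ cong (_+ nonNbrs V u) (∑-distrib-+ V _ _) ⟨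
      ∑ V (λ v → up u v + up v u) + nonNbrs V u         ≡⟨ ∑-distrib-+ V _ _ ⟨
      ∑ V (λ v → up u v + up v u + nonadj u v)          ≡⟨ ∑-cong V (λ {v} _ → pair u v) ⟩
      ∑ V (const 1)                                     ≡⟨ ∑-const V 1 ⟩
      length V * 1                                      ≡⟨ *-identityʳ _ ⟩
      length V                                          ∎

  module _ (c W : Fin n → ℕ) (k : ℕ) (cW : ∀ v → c v * W v ≡ suc k) where
    private
      M = suc k
      E = edgeCount G
      S′ = ∑ V (λ v → M ∸ W v)

      -- `n * S′` is 2M times the rational under the floor; the identity expresses its excess over
      -- 2M |E| as the defect M ne(V) - n ∑ W.
      balance : n * S′ + length V * ∑ V W ≡ E * (2 * M) + M * nonEdges V
      balance = begin
        n * S′ + length V * ∑ V W              ≡⟨ cong (λ x → x * S′ + length V * ∑ V W) (length-allFin n) ⟨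
        length V * S′ + length V * ∑ V W       ≡⟨ *-distribˡ-+ (length V) S′ _ ⟨
        length V * (S′ + ∑ V W)                ≡⟨ cong (length V *_) (∑-distrib-+ V _ _) ⟨
        length V * ∑ V (λ v → M ∸ W v + W v)   ≡⟨ cong (length V *_) (≡.trans (∑-cong V (λ {v} _ → m∸n+n≡m (W≤M v))) (∑-const V M)) ⟩
        length V * (length V * M)              ≡⟨ *-assoc (length V) (length V) M ⟨
        length V * length V * M                ≡⟨ cong (_* M) 2*edgeCount+nonEdges ⟨
        (2 * E + nonEdges V) * M               ≡⟨ eq E (nonEdges V) M ⟩
        E * (2 * M) + M * nonEdges V           ∎
        where
        open ≡-Reasoning
        eq : ∀ e x m → (2 * e + x) * m ≡ e * (2 * m) + m * x
        eq = solve-∀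
        W≤M : ∀ v → W v ≤ M
        W≤M v with c v | cW v
        ... | suc j | eq = ≤-trans (m≤m+n (W v) (j * W v)) (≤-reflexive eq)

    edgeCount≤bound : length V * ∑ V W ≤ M * nonEdges V → + E ℤ.≤ bound n c
    edgeCount≤bound le = i<suc[j]⇒i≤j (ℤ.*-cancelʳ-<-nonNeg (+ (2 * M)) (ℤ.≤-<-trans
      (subst (ℤ._≤ + (n * S′)) (ℤ.pos-* E (2 * M)) (ℤ.+≤+ (+-cancelʳ-≤ (length V * ∑ V W) _ _
        (≤-trans (+-monoʳ-≤ (E * (2 * M)) le) (≤-reflexive (≡.sym balance))))))
      (proj₂ (bound-bounds c W k cW))))

    edgeCount≡bound⇒ : + E ≡ bound n c → M * nonEdges V < length V * ∑ V W + 2 * M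
    edgeCount≡bound⇒ eq = +-cancelˡ-< (E * (2 * M)) _ _ (begin-strict
      E * (2 * M) + M * nonEdges V             ≡⟨ balance ⟨
      n * S′ + length V * ∑ V W                <⟨ +-monoˡ-< _ (ℤ.drop‿+<+ (subst (+ (n * S′) ℤ.<_) (≡.sym (ℤ.pos-* (suc E) (2 * M)))
                                                   (subst (λ f → + (n * S′) ℤ.< ℤ.suc f ℤ.* + (2 * M)) (≡.sym eq) (proj₂ (bound-bounds c W k cW))))) ⟩
      suc E * (2 * M) + length V * ∑ V W       ≡⟨ rearrange E (2 * M) _ ⟩
      E * (2 * M) + (length V * ∑ V W + 2 * M) ∎)
      where
      open ≤-Reasoning
      rearrange : ∀ e m s → suc e * m + s ≡ e * m + (s + m)
      rearrange = solve-∀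

    ⇒edgeCount≡bound : + E ℤ.≤ bound n c → M * nonEdges V < length V * ∑ V W + 2 * M → + E ≡ bound n c
    ⇒edgeCount≡bound le lt = ℤ.≤-antisym le (i<suc[j]⇒i≤j (ℤ.*-cancelʳ-<-nonNeg (+ (2 * M)) (ℤ.≤-<-trans
      (proj₁ (bound-bounds c W k cW))
      (subst (+ (n * S′) ℤ.<_) (ℤ.pos-* (suc E) (2 * M)) (ℤ.+<+ (+-cancelʳ-< (length V * ∑ V W) _ _ (begin-strict
        n * S′ + length V * ∑ V W                ≡⟨ balance ⟩
        E * (2 * M) + M * nonEdges V             <⟨ +-monoʳ-< (E * (2 * M)) lt ⟩
        E * (2 * M) + (length V * ∑ V W + 2 * M) ≡⟨ rearrange E (2 * M) _ ⟨
        suc E * (2 * M) + length V * ∑ V W       ∎)))))))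
      where
      open ≤-Reasoning
      rearrange : ∀ e m s → suc e * m + s ≡ e * m + (s + m)
      rearrange = solve-∀

theorem5 : (n : ℕ) → n ≥ 1 → (G : Graph n) → (c : Fin n → ℕ) →
    (∀ v → IsVertexCliqueNumber G v (c v)) →
    ((+ edgeCount G) ≤ℤ bound n c)
    × (((+ edgeCount G) ≡ bound n c) ⇔ (InS G ⊎ (G ≅ X ⊎ G ≅ Y)))
-- The product of all c(v) is a common multiple, and non-zero because every vertex is a clique by
-- itself.
theorem5 n n≥1 G c cliqueNumber = scaled (product (map c (allFin n)))
  (product≢0 (AllP.map⁺ (All.tabulate {xs = allFin n} λ {v} _ →
    >-nonZero (proj₂ (cliqueNumber v) (v ∷ []) ([] ∷ []) (here refl)))))
  (λ v → ∈⇒∣product (∈-map⁺ c (∈-allFin v)))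
  where
  scaled : ∀ M → NonZero M → (∀ v → c v ∣ M) →
    ((+ edgeCount G) ≤ℤ bound n c) × (((+ edgeCount G) ≡ bound n c) ⇔ (InS G ⊎ (G ≅ X ⊎ G ≅ Y)))
  -- Matching on the multiple supplies the predecessor that the denominators require.
  scaled (suc k) _ c∣M = le , mk⇔
    (λ eq → Tight.tight⇒extremal G M M>0 c W cW≡M cliqueNumber (edgeCount≡bound⇒ G c W k cW≡M eq) n≥1)
    (λ ex → ⇒edgeCount≡bound G c W k cW≡M le (extremal⇒tight G ex M M>0 c W cW≡M (proj₁ ∘ cliqueNumber)))
    where
    M = suc k
    M>0 : 0 < M
    M>0 = s≤s z≤n
    W : Fin n → ℕ
    W v = quotient (c∣M v)
    cW≡M : ∀ v → c v * W v ≡ M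
    cW≡M v = ≡.sym (m∣n⇒n≡m*quotient (c∣M v))
    le : (+ edgeCount G) ≤ℤ bound n c
    le = edgeCount≤bound G c W k cW≡M
      (Weighted.∑W≤nonEdges G M M>0 c W cW≡M {allFin n} λ K (cl , _) v∈ → proj₂ (cliqueNumber _) K cl v∈)
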